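{- Let $a_n$ be the number of pop-stacked permutations of $[n]=\{1,\dots,n\}$ and let $F(x)=\sum_{n\ge 0}a_nx^n\in\mathbb{Q}[[x]]$. If $m\ge 1$ and $p_0(x),\dots,p_m(x)\in\mathbb{Q}[x]$ with $p_m\ne 0$ satisfy \[ p_m(x)F(x)^m+\cdots+p_1(x)F(x)+p_0(x)=0, \] and $d=\max(\deg p_0,\dots,\deg p_m)$, then $(m+1)(d+1)>1000$.
   Context: For a permutation $\pi=a_1a_2\cdots a_n$ of $[n]$, a descending run of $\pi$ is a maximal sequence of consecutive letters $a_i>a_{i+1}>\cdots>a_{i+j}$. Factor $\pi$ into its descending runs, $\pi=D_1D_2\cdots D_r$; the pop-stack operator $P$ reverses each run, i.e. $P(\pi)$ is the concatenation of the reversals of $D_1,D_2,\dots,D_r$ in this order. A permutation $\sigma$ of $[n]$ is pop-stacked if $\sigma=P(\pi)$ for some permutation $\pi$ of $[n]$. The empty permutation is counted as pop-stacked, so $a_0=1$. -}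

module Defs where

import Algebra.Properties.CommutativeMonoid.Sum
open import Data.Bool using (true; false; if_then_else_)
open import Data.Fin using (Fin; toℕ)
open import Data.Integer using (+_)
open import Data.List using (List; []; _∷_; _++_; applyUpTo; concatMap; deduplicate; foldr; length; map; reverse)
open import Data.List.Membership.Propositional using (_∈_; find)
open import Data.List.Membership.Propositional.Properties using (∈-map⁺; ∈-map⁻; ∈-∃++; ∈-concatMap⁺; ∈-concatMap⁻; ∈-deduplicate⁺; ∈-deduplicate⁻)
open import Data.List.NonEmpty using (List⁺; _∷_; toList)
open import Data.List.Properties using (≡-dec)
open import Data.List.Relation.Binary.Permutation.Propositional using (_↭_; ↭-refl; ↭-sym; ↭-trans; ↭-prep; ↭-swap)
open import Data.List.Relation.Binary.Permutation.Propositional.Properties using (drop-mid; ↭-reverse; ++⁺; ∈-resp-↭; ↭-empty-inv)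
open import Data.List.Relation.Unary.All using (all?)
open import Data.List.Relation.Unary.Any using (here; there)
import Data.List.Relation.Unary.Any as Any
open import Data.List.Relation.Unary.Unique.Propositional using (Unique)
open import Data.List.Relation.Unary.Unique.DecPropositional.Properties using (deduplicate-!)
open import Data.Nat as ℕ using (ℕ; zero; suc; _∸_; _<ᵇ_; _⊔_)
open import Data.Product using (_×_; _,_; ∃-syntax)
open import Data.Rational as ℚ using (ℚ; 0ℚ; 1ℚ)
import Data.Rational.Properties as ℚ
import Data.Vec.Functional as Vector
open import Function using (_∘_; _⇔_; mk⇔)
open import Relation.Binary.Definitions using (DecidableEquality)
open import Relation.Binary.PropositionalEquality using (_≡_; refl; cong; subst)
open import Relation.Nullary using (does)

open Algebra.Properties.CommutativeMonoid.Sum ℚ.+-0-commutativeMonoid using (sum⁺-syntax)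

-- Permutations are written in one-line notation, as rearrangements of 1 2 … n.

Word : Set
Word = List ℕ

[1⋯_] : ℕ → Word
[1⋯ n ] = applyUpTo suc n

IsPermutation : ℕ → Word → Set
IsPermutation n π = π ↭ [1⋯ n ]

consRun : ℕ → List (List⁺ ℕ) → List (List⁺ ℕ)
consRun x []             = (x ∷ []) ∷ []
consRun x ((y ∷ ys) ∷ D) =
  if y <ᵇ x then (x ∷ y ∷ ys) ∷ D else (x ∷ []) ∷ (y ∷ ys) ∷ D

descendingRuns : Word → List (List⁺ ℕ)
descendingRuns = foldr consRun []

P : Word → Word
P = concatMap (reverse ∘ toList) ∘ descendingRuns

PopStacked : ℕ → Word → Set
PopStacked n σ = IsPermutation n σ × ∃[ π ] (IsPermutation n π × σ ≡ P π)

insertions : ℕ → Word → List Word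
insertions x []       = (x ∷ []) ∷ []
insertions x (y ∷ ys) = (x ∷ y ∷ ys) ∷ map (y ∷_) (insertions x ys)

permutations : Word → List Word
permutations = foldr (λ x → concatMap (insertions x)) ([] ∷ [])

_≟ʷ_ : DecidableEquality Word
_≟ʷ_ = ≡-dec ℕ._≟_

-- The image of P on the permutations of [n], listed without repetition;
-- ∈-popStacked⇔ and popStacked-unique below justify counting it.
popStacked : ℕ → List Word
popStacked n = deduplicate _≟ʷ_ (map P (permutations [1⋯ n ]))

a : ℕ → ℕ
a n = length (popStacked n)

-- Formal power series over ℚ, given by their coefficients and compared by _≗_.

Series : Set
Series = ℕ → ℚ

0ₛ : Series
0ₛ _ = 0ℚ

1ₛ : Series
1ₛ zero    = 1ℚ
1ₛ (suc _) = 0ℚ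

infixl 7 _*ₛ_
infixr 8 _^ₛ_

_*ₛ_ : Series → Series → Series
(f *ₛ g) n = ∑[ i ≤ n ] (f (toℕ i) ℚ.* g (n ∸ toℕ i))

_^ₛ_ : Series → ℕ → Series
f ^ₛ zero  = 1ₛ
f ^ₛ suc k = f *ₛ (f ^ₛ k)

F : Series
F n = + a n ℚ./ 1

-- Coefficients in increasing degree; trailing zeros are allowed, so a
-- polynomial is zero when ⟦ p ⟧ ≗ 0ₛ, not only when p is the empty list.
Poly : Set
Poly = List ℚ

⟦_⟧ : Poly → Series
⟦ [] ⟧    _       = 0ℚ
⟦ c ∷ p ⟧ zero    = c
⟦ c ∷ p ⟧ (suc k) = ⟦ p ⟧ k

-- The index of the last nonzero coefficient.  The zero polynomial gets degree
-- 0, which does not affect a maximum over a family with a nonzero member.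
degree : Poly → ℕ
degree []      = 0
degree (c ∷ p) = if does (all? (ℚ._≟ 0ℚ) p) then 0 else suc (degree p)

maxDegree : ∀ {m} → (Fin (suc m) → Poly) → ℕ
maxDegree p = Vector.foldr _⊔_ 0 (degree ∘ p)

-- p₀ + p₁ f + ⋯ + pₘ fᵐ
evalAt : ∀ {m} → (Fin (suc m) → Poly) → Series → Series
evalAt {m} p f n = ∑[ j ≤ m ] ((⟦ p j ⟧ *ₛ (f ^ₛ toℕ j)) n)

private
  insertions-sound : ∀ x xs {σ} → σ ∈ insertions x xs → σ ↭ x ∷ xs
  insertions-sound x []       (here refl) = ↭-refl
  insertions-sound x (y ∷ ys) (here refl) = ↭-refl
  insertions-sound x (y ∷ ys) (there σ∈) with ∈-map⁻ (y ∷_) σ∈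
  ... | τ , τ∈ , refl = ↭-trans (↭-prep y (insertions-sound x ys τ∈)) (↭-swap y x ↭-refl)

  insertions-complete : ∀ x ys zs → (ys ++ x ∷ zs) ∈ insertions x (ys ++ zs)
  insertions-complete x []       []       = here refl
  insertions-complete x []       (z ∷ zs) = here refl
  insertions-complete x (y ∷ ys) zs       =
    there (∈-map⁺ (y ∷_) (insertions-complete x ys zs))

  permutations-sound : ∀ xs {σ} → σ ∈ permutations xs → σ ↭ xs
  permutations-sound []       (here refl) = ↭-refl
  permutations-sound (x ∷ xs) σ∈
    with τ , τ∈ , σ∈τ ← find (∈-concatMap⁻ (insertions x) {xs = permutations xs} σ∈) =
    ↭-trans (insertions-sound x τ σ∈τ) (↭-prep x (permutations-sound xs τ∈))

  permutations-complete : ∀ xs {σ} → σ ↭ xs → σ ∈ permutations xs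
  permutations-complete []       σ↭ with refl ← ↭-empty-inv σ↭ = here refl
  permutations-complete (x ∷ xs) σ↭
    with ys , zs , refl ← ∈-∃++ (∈-resp-↭ (↭-sym σ↭) (here refl)) =
    ∈-concatMap⁺ (insertions x)
      (Any.map (λ { refl → insertions-complete x ys zs })
        (permutations-complete xs (drop-mid ys [] σ↭)))

  flatten : List (List⁺ ℕ) → Word
  flatten = concatMap toList

  flatten-consRun : ∀ x D → flatten (consRun x D) ≡ x ∷ flatten D
  flatten-consRun x []             = refl
  flatten-consRun x ((y ∷ ys) ∷ D) with y <ᵇ x
  ... | true  = refl
  ... | false = refl

  reverse-runs-↭ : ∀ D → concatMap (reverse ∘ toList) D ↭ flatten D
  reverse-runs-↭ []      = ↭-refl
  reverse-runs-↭ (d ∷ D) = ++⁺ (↭-reverse (toList d)) (reverse-runs-↭ D)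

flatten-descendingRuns : ∀ π → concatMap toList (descendingRuns π) ≡ π
flatten-descendingRuns []      = refl
flatten-descendingRuns (x ∷ π)
  rewrite flatten-consRun x (descendingRuns π) = cong (x ∷_) (flatten-descendingRuns π)

P-↭ : ∀ π → P π ↭ π
P-↭ π = subst (P π ↭_) (flatten-descendingRuns π) (reverse-runs-↭ (descendingRuns π))

∈-permutations⇔ : ∀ xs {σ} → σ ∈ permutations xs ⇔ (σ ↭ xs)
∈-permutations⇔ xs = mk⇔ (permutations-sound xs) (permutations-complete xs)

∈-popStacked⇔ : ∀ n {σ} → σ ∈ popStacked n ⇔ PopStacked n σ
∈-popStacked⇔ n {σ} = mk⇔ to from
  where
  to : σ ∈ popStacked n → PopStacked n σ
  to σ∈ with ∈-map⁻ P (∈-deduplicate⁻ _≟ʷ_ (map P (permutations [1⋯ n ])) σ∈)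
  ... | π , π∈ , refl = ↭-trans (P-↭ π) π↭ , π , π↭ , refl
    where
    π↭ : IsPermutation n π
    π↭ = permutations-sound [1⋯ n ] π∈

  from : PopStacked n σ → σ ∈ popStacked n
  from (_ , π , π↭ , refl) =
    ∈-deduplicate⁺ _≟ʷ_ (∈-map⁺ P (permutations-complete [1⋯ n ] π↭))

popStacked-unique : ∀ n → Unique (popStacked n)
popStacked-unique n = deduplicate-! _≟ʷ_ (map P (permutations [1⋯ n ]))

{-# OPTIONS --safe #-}

-- F is not algebraic at all.  Indeed a series f with p(f) = 0, where the
-- coefficients of p are absolutely summable series, has coefficients of at most
-- exponential growth.  Replacing p by its derivative as long as p′(f) = 0, we
-- may assume that p′(f) has a finite order s.  Write f = t + x^(s+1) y with t
-- the truncation of f after degree s.  Taylor expansion at t gives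
-- u₀ y = - (q + x w), where u₀ ≠ 0 is the coefficient of x^s in p′(f), q is
-- summable, and w is a polynomial expression in y with summable coefficients.
-- For small r > 0 this recursion keeps the partial sums of Σ |yₙ| rⁿ bounded.
-- On the other hand a₂ₖ ≥ k!, since τ₁ (k+1) τ₂ (k+2) ⋯ τₖ (2k) is pop-stacked
-- for every permutation τ of [k].
module Submission where

open import Defs
open import Algebra.Bundles using (CommutativeMonoid; CommutativeSemiring)
import Algebra.Construct.Pointwise as Pointwise
import Algebra.Properties.CommutativeMonoid.Mult as CommutativeMonoidMult
import Algebra.Properties.CommutativeMonoid.Sum as CommutativeMonoidSum
import Algebra.Properties.Group as GroupProperties
import Algebra.Properties.Semiring.Exp as SemiringExp
import Algebra.Properties.Semiring.Mult as SemiringMult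
import Algebra.Properties.Semiring.Sum as SemiringSum
import Algebra.Solver.Ring.NaturalCoefficients.Default as SemiringSolver
open import Data.Bool using (true; false; T)
open import Data.Fin using (Fin; zero; suc; toℕ; fromℕ)
import Data.Integer as ℤ
import Data.Integer.Properties as ℤ
open import Data.List as List using (List; []; _∷_; _++_; applyUpTo; concatMap; filter; length; map)
open import Data.List.Membership.Propositional using (_∈_; find)
open import Data.List.Membership.Propositional.Properties
  using (∈-++⁺ˡ; ∈-++⁺ʳ; ∈-++⁻; ∈-∃++; ∈-concatMap⁻; ∈-map⁻)
open import Data.List.NonEmpty using (List⁺; _∷_; toList)
open import Data.List.Properties
  using (∷-injectiveˡ; ∷-injectiveʳ; filter-all; filter-accept; filter-reject; length-++; length-++-sucʳ; length-map; length-applyUpTo)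
open import Data.List.Relation.Binary.Permutation.Propositional
  using (_↭_; ↭-refl; ↭-sym; ↭-trans; ↭-prep; ↭-swap; ↭-reflexive)
open import Data.List.Relation.Binary.Permutation.Propositional.Properties using (All-resp-↭; ↭-length; shift; ++⁺ʳ)
open import Data.List.Relation.Unary.All as All using (All; []; _∷_)
import Data.List.Relation.Unary.All.Properties as All
open import Data.List.Relation.Unary.AllPairs using ([]; _∷_)
open import Data.List.Relation.Unary.Any using (here; there)
open import Data.List.Relation.Unary.Unique.Propositional using (Unique)
import Data.List.Relation.Unary.Unique.Propositional.Properties as Unique
open import Data.Nat as ℕ using (ℕ; zero; suc; z≤n; s≤s)
import Data.Nat.Properties as ℕ
open import Data.Product using (_×_; _,_; ∃-syntax; proj₁; proj₂)
open import Data.Rational as ℚ using (ℚ; 0ℚ; 1ℚ)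
import Data.Rational.Properties as ℚ
import Data.Rational.Unnormalised as ℚᵘ
import Data.Rational.Unnormalised.Properties as ℚᵘ
open import Data.Sum using (inj₁; inj₂)
open import Data.Vec.Functional using (Vector)
open import Function using (_∘_; Equivalence)
open import Level using (0ℓ)
open import Relation.Binary.PropositionalEquality
  using (_≡_; _≢_; _≗_; refl; sym; trans; cong; cong₂; subst; module ≡-Reasoning)
import Relation.Binary.Reasoning.Setoid as SetoidReasoning
open import Relation.Nullary using (¬_; ¬?; yes; no; contradiction)

-- Evaluation of polynomials over a commutative semiring

module Polynomial {c ℓ} (R : CommutativeSemiring c ℓ) where
  open CommutativeSemiring R hiding (zero) renaming (refl to ≈-refl; sym to ≈-sym; trans to ≈-trans)
  open SemiringMult semiring using (×-assoc-*; ×-comm-*; ×-congʳ) renaming (_×_ to _×ᶜ_)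
  open CommutativeMonoidMult +-commutativeMonoid using (×-distrib-+)
  open SemiringExp semiring using (_^_)
  open SemiringSum semiring using (sum; sum-cong-≋; *-distribˡ-sum)
  open SemiringSolver R using (solve; _:=_; _:+_; _:*_; con)
  open SetoidReasoning setoid

  -- Horner's scheme: every later induction peels off the constant coefficient.
  eval : ∀ {n} → Vector Carrier n → Carrier → Carrier
  eval {zero}  p x = 0#
  eval {suc n} p x = p zero + x * eval (p ∘ suc) x

  -- The product rule for p₀ + x g(x), so that no integer multiples of coefficients enter.
  eval′ : ∀ {n} → Vector Carrier n → Carrier → Carrier
  eval′ {zero}  p x = 0#
  eval′ {suc n} p x = eval (p ∘ suc) x + x * eval′ (p ∘ suc) x

  -- The cofactor r in p(x) = p(t) + h p′(t) + h² r, where x = t + h.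
  remainder : ∀ {n} → Vector Carrier n → Carrier → Carrier → Carrier
  remainder {zero}  p t x = 0#
  remainder {suc n} p t x = eval′ (p ∘ suc) t + x * remainder (p ∘ suc) t x

  -- Multiply the expansion of the tail by x. The factor x becomes t + h only in front of e + h e′;
  -- the term in h² keeps it, just as `remainder` does.
  taylor : ∀ {n} (p : Vector Carrier n) {t h x} → x ≈ t + h →
           eval p x ≈ eval p t + (h * eval′ p t + h * h * remainder p t x)
  taylor {zero}  p {t} {h} x≈ =
    solve 1 (λ h → con 0 := con 0 :+ (h :* con 0 :+ h :* h :* con 0)) ≈-refl h
  taylor {suc n} p {t} {h} {x} x≈ = begin
    p zero + x * eval (p ∘ suc) x
      ≈⟨ +-congˡ (*-congˡ (taylor (p ∘ suc) x≈)) ⟩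
    p zero + x * (e + (h * e′ + h * h * r))
      ≈⟨ solve 6 (λ p₀ x h e e′ r →
           p₀ :+ x :* (e :+ (h :* e′ :+ h :* h :* r)) :=
           p₀ :+ (x :* (e :+ h :* e′) :+ h :* h :* (x :* r))) ≈-refl (p zero) x h e e′ r ⟩
    p zero + (x * (e + h * e′) + h * h * (x * r))
      ≈⟨ +-congˡ (+-congʳ (*-congʳ x≈)) ⟩
    p zero + ((t + h) * (e + h * e′) + h * h * (x * r))
      ≈⟨ solve 7 (λ p₀ t x h e e′ r →
           p₀ :+ ((t :+ h) :* (e :+ h :* e′) :+ h :* h :* (x :* r)) :=
           (p₀ :+ t :* e) :+ (h :* (e :+ t :* e′) :+ h :* h :* (e′ :+ x :* r)))
           ≈-refl (p zero) t x h e e′ r ⟩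
    (p zero + t * e) + (h * (e + t * e′) + h * h * (e′ + x * r)) ∎
    where
    e e′ r : Carrier
    e  = eval (p ∘ suc) t
    e′ = eval′ (p ∘ suc) t
    r  = remainder (p ∘ suc) t x

  -- The coefficients (k + i) pᵢ; the offset k grows along the recursion. With k = 1 and `p ∘ suc`
  -- they are the coefficients of p′.
  weighted : ∀ {n} → ℕ → Vector Carrier n → Vector Carrier n
  weighted k p zero    = k ×ᶜ p zero
  weighted k p (suc i) = weighted (suc k) (p ∘ suc) i

  -- The weights i contribute x p′(x), and the constant offset k contributes k p(x).
  eval-weighted : ∀ {n} k (p : Vector Carrier n) x →
                  eval (weighted k p) x ≈ k ×ᶜ eval p x + x * eval′ p x
  eval-weighted {zero}  k p x = begin
    0#                ≈⟨ zeroʳ (k ×ᶜ 1#) ⟨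
    k ×ᶜ 1# * 0#      ≈⟨ ×-assoc-* k 1# 0# ⟩
    k ×ᶜ (1# * 0#)    ≈⟨ ×-congʳ k (zeroʳ 1#) ⟩
    k ×ᶜ 0#           ≈⟨ solve 2 (λ y x → y := y :+ x :* con 0) ≈-refl (k ×ᶜ 0#) x ⟩
    k ×ᶜ 0# + x * 0#  ∎
  eval-weighted {suc n} k p x = begin
    k ×ᶜ p zero + x * eval (weighted (suc k) (p ∘ suc)) x
      ≈⟨ +-congˡ (*-congˡ (eval-weighted (suc k) (p ∘ suc) x)) ⟩
    k ×ᶜ p zero + x * (e + k ×ᶜ e + x * e′)
      ≈⟨ solve 5 (λ y x e z e′ → y :+ x :* (e :+ z :+ x :* e′) := y :+ x :* z :+ x :* (e :+ x :* e′))
           ≈-refl (k ×ᶜ p zero) x e (k ×ᶜ e) e′ ⟩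
    k ×ᶜ p zero + x * k ×ᶜ e + x * (e + x * e′)
      ≈⟨ +-congʳ (+-congˡ (×-comm-* k x e)) ⟩
    k ×ᶜ p zero + k ×ᶜ (x * e) + x * (e + x * e′)
      ≈⟨ +-congʳ (×-distrib-+ (p zero) (x * e) k) ⟨
    k ×ᶜ (p zero + x * e) + x * (e + x * e′) ∎
    where
    e e′ : Carrier
    e  = eval (p ∘ suc) x
    e′ = eval′ (p ∘ suc) x

  derivative : ∀ {n} → Vector Carrier (suc n) → Vector Carrier n
  derivative p = weighted 1 (p ∘ suc)

  eval-derivative : ∀ {n} (p : Vector Carrier (suc n)) x → eval (derivative p) x ≈ eval′ p x
  eval-derivative p x = ≈-trans (eval-weighted 1 (p ∘ suc) x) (+-congʳ (+-identityʳ _))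

  -- Links Horner's scheme to the sum of powers in `evalAt`.
  eval≈sum : ∀ {n} (p : Vector Carrier n) x → eval p x ≈ sum (λ j → p j * x ^ toℕ j)
  eval≈sum {zero}  p x = ≈-refl
  eval≈sum {suc n} p x = +-cong (≈-sym (*-identityʳ (p zero))) (begin
    x * eval (p ∘ suc) x
      ≈⟨ *-congˡ (eval≈sum (p ∘ suc) x) ⟩
    x * sum (λ j → p (suc j) * x ^ toℕ j)
      ≈⟨ *-distribˡ-sum x (λ j → p (suc j) * x ^ toℕ j) ⟩
    sum (λ j → x * (p (suc j) * x ^ toℕ j))
      ≈⟨ sum-cong-≋ (λ j → solve 3 (λ x p y → x :* (p :* y) := p :* (x :* y)) ≈-refl x (p (suc j)) (x ^ toℕ j)) ⟩
    sum (λ j → p (suc j) * x ^ suc (toℕ j)) ∎)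

module _ where
  open import Data.Rational using (_+_; _*_; _≤_; ∣_∣)
  open import Data.Rational.Solver using (module +-*-Solver)
  open +-*-Solver using (solve; _:=_; _:+_; _:*_; con)
  open import Algebra.Structures.Biased {A = Series} _≗_ using (isCommutativeMonoidˡ; isCommutativeSemiringˡ)

  -- The ring of formal power series

  infixl 6 _+ₛ_
  infixl 7 _·_

  _+ₛ_ : Series → Series → Series
  (f +ₛ g) n = f n + g n

  _·_ : ℚ → Series → Series
  (q · f) n = q * f n

  tail : Series → Series
  tail f n = f (suc n)

  -- The convolution at n reads no coefficient beyond n. Agreement up to n is all that a truncation
  -- can provide.
  *ₛ-cong-≤ : ∀ n {f f′ g g′} → (∀ {i} → i ℕ.≤ n → f i ≡ f′ i) → (∀ {i} → i ℕ.≤ n → g i ≡ g′ i) →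
              (f *ₛ g) n ≡ (f′ *ₛ g′) n
  *ₛ-cong-≤ zero    f≈ g≈ = cong₂ (λ x y → x * y + 0ℚ) (f≈ z≤n) (g≈ z≤n)
  *ₛ-cong-≤ (suc n) f≈ g≈ = cong₂ _+_ (cong₂ _*_ (f≈ z≤n) (g≈ ℕ.≤-refl))
    (*ₛ-cong-≤ n (f≈ ∘ s≤s) (g≈ ∘ ℕ.m≤n⇒m≤1+n))

  *ₛ-cong : ∀ {f f′ g g′} → f ≗ f′ → g ≗ g′ → f *ₛ g ≗ f′ *ₛ g′
  *ₛ-cong f≗ g≗ n = *ₛ-cong-≤ n (λ {i} _ → f≗ i) (λ {i} _ → g≗ i)

  *ₛ-distribʳ-+ₛ : ∀ h f g → (f +ₛ g) *ₛ h ≗ f *ₛ h +ₛ g *ₛ h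
  *ₛ-distribʳ-+ₛ h f g zero =
    solve 3 (λ f₀ g₀ h₀ → (f₀ :+ g₀) :* h₀ :+ con 0ℚ := (f₀ :* h₀ :+ con 0ℚ) :+ (g₀ :* h₀ :+ con 0ℚ))
      refl (f 0) (g 0) (h 0)
  *ₛ-distribʳ-+ₛ h f g (suc n) = trans
    (cong ((f 0 + g 0) * h (suc n) +_) (*ₛ-distribʳ-+ₛ h (tail f) (tail g) n))
    (solve 5 (λ f₀ g₀ h₁ x y → (f₀ :+ g₀) :* h₁ :+ (x :+ y) := (f₀ :* h₁ :+ x) :+ (g₀ :* h₁ :+ y))
      refl (f 0) (g 0) (h (suc n)) ((tail f *ₛ h) n) ((tail g *ₛ h) n))

  ·-*ₛ-assoc : ∀ q f g → q · f *ₛ g ≗ q · (f *ₛ g)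
  ·-*ₛ-assoc q f g zero =
    solve 3 (λ q x y → q :* x :* y :+ con 0ℚ := q :* (x :* y :+ con 0ℚ)) refl q (f 0) (g 0)
  ·-*ₛ-assoc q f g (suc n) = trans
    (cong (q * f 0 * g (suc n) +_) (·-*ₛ-assoc q (tail f) g n))
    (solve 4 (λ q x y z → q :* x :* y :+ q :* z := q :* (x :* y :+ z))
      refl q (f 0) (g (suc n)) ((tail f *ₛ g) n))

  -- By computation a product unfolds along the first coefficient of its left factor; commutativity
  -- also requires unfolding along the right one.
  *ₛ-sucʳ : ∀ f g n → (f *ₛ g) (suc n) ≡ (f *ₛ tail g) n + f (suc n) * g 0
  *ₛ-sucʳ f g zero =
    solve 4 (λ f₀ f₁ g₀ g₁ → f₀ :* g₁ :+ (f₁ :* g₀ :+ con 0ℚ) := (f₀ :* g₁ :+ con 0ℚ) :+ f₁ :* g₀)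
      refl (f 0) (f 1) (g 0) (g 1)
  *ₛ-sucʳ f g (suc n) = trans
    (cong (f 0 * g (suc (suc n)) +_) (*ₛ-sucʳ (tail f) g n))
    (sym (ℚ.+-assoc (f 0 * g (suc (suc n))) _ _))

  *ₛ-comm : ∀ f g → f *ₛ g ≗ g *ₛ f
  *ₛ-comm f g zero    = cong (_+ 0ℚ) (ℚ.*-comm (f 0) (g 0))
  *ₛ-comm f g (suc n) = begin
    f 0 * g (suc n) + (tail f *ₛ g) n  ≡⟨ cong₂ _+_ (ℚ.*-comm (f 0) _) (*ₛ-comm (tail f) g n) ⟩
    g (suc n) * f 0 + (g *ₛ tail f) n  ≡⟨ ℚ.+-comm (g (suc n) * f 0) _ ⟩
    (g *ₛ tail f) n + g (suc n) * f 0  ≡⟨ *ₛ-sucʳ g f n ⟨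
    (g *ₛ f) (suc n)                   ∎
    where open ≡-Reasoning

  *ₛ-assoc : ∀ f g h → (f *ₛ g) *ₛ h ≗ f *ₛ (g *ₛ h)
  *ₛ-assoc f g h zero =
    solve 3 (λ x y z → (x :* y :+ con 0ℚ) :* z :+ con 0ℚ := x :* (y :* z :+ con 0ℚ) :+ con 0ℚ)
      refl (f 0) (g 0) (h 0)
  *ₛ-assoc f g h (suc n) = begin
    -- By computation `tail (f *ₛ g)` is `f 0 · tail g +ₛ tail f *ₛ g`, so distributivity applies.
    (f 0 * g 0 + 0ℚ) * h (suc n) + ((f 0 · tail g +ₛ tail f *ₛ g) *ₛ h) n
      ≡⟨ cong ((f 0 * g 0 + 0ℚ) * h (suc n) +_) (*ₛ-distribʳ-+ₛ h (f 0 · tail g) (tail f *ₛ g) n) ⟩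
    (f 0 * g 0 + 0ℚ) * h (suc n) + ((f 0 · tail g *ₛ h) n + (tail f *ₛ g *ₛ h) n)
      ≡⟨ cong₂ (λ x y → (f 0 * g 0 + 0ℚ) * h (suc n) + (x + y))
           (·-*ₛ-assoc (f 0) (tail g) h n) (*ₛ-assoc (tail f) g h n) ⟩
    (f 0 * g 0 + 0ℚ) * h (suc n) + (f 0 * (tail g *ₛ h) n + (tail f *ₛ (g *ₛ h)) n)
      ≡⟨ solve 5 (λ x y z u v → (x :* y :+ con 0ℚ) :* z :+ (x :* u :+ v) := x :* (y :* z :+ u) :+ v)
           refl (f 0) (g 0) (h (suc n)) ((tail g *ₛ h) n) ((tail f *ₛ (g *ₛ h)) n) ⟩
    f 0 * (g 0 * h (suc n) + (tail g *ₛ h) n) + (tail f *ₛ (g *ₛ h)) n ∎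
    where open ≡-Reasoning

  *ₛ-zeroˡ : ∀ f → 0ₛ *ₛ f ≗ 0ₛ
  *ₛ-zeroˡ f zero    = solve 1 (λ x → con 0ℚ :* x :+ con 0ℚ := con 0ℚ) refl (f 0)
  *ₛ-zeroˡ f (suc n) = trans (cong (0ℚ * f (suc n) +_) (*ₛ-zeroˡ f n))
    (solve 1 (λ x → con 0ℚ :* x :+ con 0ℚ := con 0ℚ) refl (f (suc n)))

  *ₛ-identityˡ : ∀ f → 1ₛ *ₛ f ≗ f
  *ₛ-identityˡ f zero    = solve 1 (λ x → con 1ℚ :* x :+ con 0ℚ := x) refl (f 0)
  *ₛ-identityˡ f (suc n) = trans (cong (1ℚ * f (suc n) +_) (*ₛ-zeroˡ f n))
    (solve 1 (λ x → con 1ℚ :* x :+ con 0ℚ := x) refl (f (suc n)))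

  *ₛ-+ₛ-commutativeSemiring : CommutativeSemiring 0ℓ 0ℓ
  *ₛ-+ₛ-commutativeSemiring = record
    { Carrier = Series
    ; _≈_ = _≗_
    ; _+_ = _+ₛ_
    ; _*_ = _*ₛ_
    ; 0# = 0ₛ
    ; 1# = 1ₛ
    ; isCommutativeSemiring = isCommutativeSemiringˡ record
      { +-isCommutativeMonoid = +ₛ.isCommutativeMonoid
      ; *-isCommutativeMonoid = isCommutativeMonoidˡ record
        { isSemigroup = record
          { isMagma = record { isEquivalence = +ₛ.isEquivalence ; ∙-cong = *ₛ-cong }
          ; assoc = *ₛ-assoc
          }
        ; identityˡ = *ₛ-identityˡ
        ; comm = *ₛ-comm
        }
      ; distribʳ = *ₛ-distribʳ-+ₛ
      ; zeroˡ = *ₛ-zeroˡ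
      }
    }
    where module +ₛ = CommutativeMonoid (Pointwise.commutativeMonoid ℕ ℚ.+-0-commutativeMonoid)

  module S = CommutativeSemiring *ₛ-+ₛ-commutativeSemiring

  open Polynomial *ₛ-+ₛ-commutativeSemiring
  open SemiringMult S.semiring using () renaming (_×_ to _×ₛ_)

  -- Shifts and truncations

  X·_ : Series → Series
  (X· f) zero    = 0ℚ
  (X· f) (suc n) = f n

  X^_·_ : ℕ → Series → Series
  X^ zero  · f = f
  X^ suc k · f = X· (X^ k · f)

  drop : ℕ → Series → Series
  drop zero    f = f
  drop (suc k) f = drop k (tail f)

  truncate : ℕ → Series → Series
  truncate zero    f         = 0ₛ
  truncate (suc k) f zero    = f 0
  truncate (suc k) f (suc n) = truncate k (tail f) n

  X·-cong : ∀ {f g} → f ≗ g → X· f ≗ X· g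
  X·-cong f≗g zero    = refl
  X·-cong f≗g (suc n) = f≗g n

  X^·-cong : ∀ k {f g} → f ≗ g → X^ k · f ≗ X^ k · g
  X^·-cong zero    f≗g = f≗g
  X^·-cong (suc k) f≗g = X·-cong (X^·-cong k f≗g)

  X·-*ₛ : ∀ f g → (X· f) *ₛ g ≗ X· (f *ₛ g)
  X·-*ₛ f g zero    = trans (ℚ.+-identityʳ _) (ℚ.*-zeroˡ (g 0))
  X·-*ₛ f g (suc n) = trans (cong (_+ (f *ₛ g) n) (ℚ.*-zeroˡ (g (suc n)))) (ℚ.+-identityˡ _)

  X^·-*ₛ : ∀ k f g → (X^ k · f) *ₛ g ≗ X^ k · (f *ₛ g)
  X^·-*ₛ zero    f g n = refl
  X^·-*ₛ (suc k) f g n = trans (X·-*ₛ (X^ k · f) g n) (X·-cong (X^·-*ₛ k f g) n)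

  *ₛ-X^· : ∀ k f g → f *ₛ (X^ k · g) ≗ X^ k · (f *ₛ g)
  *ₛ-X^· k f g n = trans (*ₛ-comm f (X^ k · g) n)
    (trans (X^·-*ₛ k g f n) (X^·-cong k (*ₛ-comm g f) n))

  X·-+ₛ : ∀ f g → X· f +ₛ X· g ≗ X· (f +ₛ g)
  X·-+ₛ f g zero    = refl
  X·-+ₛ f g (suc n) = refl

  X^·-+ₛ : ∀ k f g → X^ k · f +ₛ X^ k · g ≗ X^ k · (f +ₛ g)
  X^·-+ₛ zero    f g n = refl
  X^·-+ₛ (suc k) f g n = trans (X·-+ₛ (X^ k · f) (X^ k · g) n) (X·-cong (X^·-+ₛ k f g) n)

  X·-X^· : ∀ k f → X· (X^ k · f) ≗ X^ k · (X· f)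
  X·-X^· zero    f n = refl
  X·-X^· (suc k) f = X·-cong (X·-X^· k f)

  drop-cong : ∀ k {f g} → f ≗ g → drop k f ≗ drop k g
  drop-cong zero    f≗g = f≗g
  drop-cong (suc k) f≗g = drop-cong k (f≗g ∘ suc)

  drop-+ₛ : ∀ k f g → drop k (f +ₛ g) ≗ drop k f +ₛ drop k g
  drop-+ₛ zero    f g n = refl
  drop-+ₛ (suc k) f g   = drop-+ₛ k (tail f) (tail g)

  -- An equality of functions, not only of their values, because `tail (X· f)` computes to `f`.
  drop-X^· : ∀ k f → drop k (X^ k · f) ≡ f
  drop-X^· zero    f = refl
  drop-X^· (suc k) f = drop-X^· k f

  drop-at : ∀ k f n → drop k f n ≡ f (n ℕ.+ k)
  drop-at zero    f n = cong f (sym (ℕ.+-identityʳ n))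
  drop-at (suc k) f n = trans (drop-at k (tail f) n) (cong f (sym (ℕ.+-suc n k)))

  X^·-drop : ∀ k f → (∀ i → i ℕ.< k → f i ≡ 0ℚ) → f ≗ X^ k · drop k f
  X^·-drop zero    f f<k n       = refl
  X^·-drop (suc k) f f<k zero    = f<k 0 (s≤s z≤n)
  X^·-drop (suc k) f f<k (suc n) = X^·-drop k (tail f) (λ i i<k → f<k (suc i) (s≤s i<k)) n

  truncate+X^·drop : ∀ k f → f ≗ truncate k f +ₛ X^ k · drop k f
  truncate+X^·drop zero    f n       = sym (ℚ.+-identityˡ (f n))
  truncate+X^·drop (suc k) f zero    = sym (ℚ.+-identityʳ (f 0))
  truncate+X^·drop (suc k) f (suc n) = truncate+X^·drop k (tail f) n

  truncate-< : ∀ k f {i} → i ℕ.< k → truncate k f i ≡ f i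
  truncate-< (suc k) f {zero}  i<k       = refl
  truncate-< (suc k) f {suc i} (s≤s i<k) = truncate-< k (tail f) i<k

  eval-cong-≤ : ∀ {m} (p : Vector Series m) {f g} n → (∀ {i} → i ℕ.≤ n → f i ≡ g i) →
                ∀ {i} → i ℕ.≤ n → eval p f i ≡ eval p g i
  eval-cong-≤ {zero}  p n f≈g i≤n = refl
  eval-cong-≤ {suc m} p n f≈g {i} i≤n = cong (p zero i +_)
    (*ₛ-cong-≤ i (λ j≤i → f≈g (ℕ.≤-trans j≤i i≤n))
                 (λ j≤i → eval-cong-≤ (p ∘ suc) n f≈g (ℕ.≤-trans j≤i i≤n)))

  eval′-cong-≤ : ∀ {m} (p : Vector Series m) {f g} n → (∀ {i} → i ℕ.≤ n → f i ≡ g i) →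
                 ∀ {i} → i ℕ.≤ n → eval′ p f i ≡ eval′ p g i
  eval′-cong-≤ {zero}  p n f≈g i≤n = refl
  eval′-cong-≤ {suc m} p n f≈g {i} i≤n = cong₂ _+_ (eval-cong-≤ (p ∘ suc) n f≈g i≤n)
    (*ₛ-cong-≤ i (λ j≤i → f≈g (ℕ.≤-trans j≤i i≤n))
                 (λ j≤i → eval′-cong-≤ (p ∘ suc) n f≈g (ℕ.≤-trans j≤i i≤n)))

  -- The truncated norms Σ_{n < N} |fₙ| rⁿ

  ‖_‖ : Series → ℚ → ℕ → ℚ
  ‖ f ‖ r zero    = 0ℚ
  ‖ f ‖ r (suc N) = ∣ f 0 ∣ + r * ‖ tail f ‖ r N

  *-mono-≤-nonNeg : ∀ {p q u v} → 0ℚ ≤ p → p ≤ q → 0ℚ ≤ u → u ≤ v → p * u ≤ q * v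
  *-mono-≤-nonNeg {p} {q} {u} {v} 0≤p p≤q 0≤u u≤v = ℚ.≤-trans
    (ℚ.*-monoʳ-≤-nonNeg u {{ℚ.nonNegative 0≤u}} p≤q)
    (ℚ.*-monoˡ-≤-nonNeg q {{ℚ.nonNegative (ℚ.≤-trans 0≤p p≤q)}} u≤v)

  0≤p*q : ∀ {p q} → 0ℚ ≤ p → 0ℚ ≤ q → 0ℚ ≤ p * q
  0≤p*q {p} {q} 0≤p 0≤q = subst (_≤ p * q) (ℚ.*-zeroˡ 0ℚ) (*-mono-≤-nonNeg ℚ.≤-refl 0≤p ℚ.≤-refl 0≤q)

  -- Comparing absolute values only lets this serve for equal series and for opposite ones.
  ‖‖-cong-∣∣ : ∀ {f g} → (∀ n → ∣ f n ∣ ≡ ∣ g n ∣) → ∀ r N → ‖ f ‖ r N ≡ ‖ g ‖ r N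
  ‖‖-cong-∣∣ f≈g r zero    = refl
  ‖‖-cong-∣∣ f≈g r (suc N) = cong₂ (λ x y → x + r * y) (f≈g 0) (‖‖-cong-∣∣ (f≈g ∘ suc) r N)

  module _ {r} (0≤r : 0ℚ ≤ r) where
    open ℚ.≤-Reasoning

    r*-mono : ∀ {p q} → p ≤ q → r * p ≤ r * q
    r*-mono = ℚ.*-monoˡ-≤-nonNeg r {{ℚ.nonNegative 0≤r}}

    0≤‖‖ : ∀ f N → 0ℚ ≤ ‖ f ‖ r N
    0≤‖‖ f zero    = ℚ.≤-refl
    0≤‖‖ f (suc N) = ℚ.+-mono-≤ (ℚ.0≤∣p∣ (f 0)) (0≤p*q 0≤r (0≤‖‖ (tail f) N))

    ‖‖≤‖‖-suc : ∀ f N → ‖ f ‖ r N ≤ ‖ f ‖ r (suc N)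
    ‖‖≤‖‖-suc f zero    = 0≤‖‖ f 1
    ‖‖≤‖‖-suc f (suc N) = ℚ.+-monoʳ-≤ ∣ f 0 ∣ (r*-mono (‖‖≤‖‖-suc (tail f) N))

    ‖‖-+ₛ : ∀ f g N → ‖ f +ₛ g ‖ r N ≤ ‖ f ‖ r N + ‖ g ‖ r N
    ‖‖-+ₛ f g zero    = ℚ.≤-refl
    ‖‖-+ₛ f g (suc N) = begin
      ∣ f 0 + g 0 ∣ + r * ‖ tail f +ₛ tail g ‖ r N
        ≤⟨ ℚ.+-mono-≤ (ℚ.∣p+q∣≤∣p∣+∣q∣ (f 0) (g 0)) (r*-mono (‖‖-+ₛ (tail f) (tail g) N)) ⟩
      (∣ f 0 ∣ + ∣ g 0 ∣) + r * (‖ tail f ‖ r N + ‖ tail g ‖ r N)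
        ≡⟨ solve 5 (λ x y r u v → (x :+ y) :+ r :* (u :+ v) := (x :+ r :* u) :+ (y :+ r :* v))
             refl ∣ f 0 ∣ ∣ g 0 ∣ r _ _ ⟩
      ‖ f ‖ r (suc N) + ‖ g ‖ r (suc N) ∎

    ‖‖-· : ∀ q f N → ‖ q · f ‖ r N ≡ ∣ q ∣ * ‖ f ‖ r N
    ‖‖-· q f zero    = sym (ℚ.*-zeroʳ ∣ q ∣)
    ‖‖-· q f (suc N) = begin-equality
      ∣ q * f 0 ∣ + r * ‖ q · tail f ‖ r N
        ≡⟨ cong₂ (λ x y → x + r * y) (ℚ.∣p*q∣≡∣p∣*∣q∣ q (f 0)) (‖‖-· q (tail f) N) ⟩
      ∣ q ∣ * ∣ f 0 ∣ + r * (∣ q ∣ * ‖ tail f ‖ r N)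
        ≡⟨ solve 4 (λ q x r y → q :* x :+ r :* (q :* y) := q :* (x :+ r :* y)) refl ∣ q ∣ ∣ f 0 ∣ r _ ⟩
      ∣ q ∣ * ‖ f ‖ r (suc N) ∎

    -- The pairs of indices with i + j < N are among those with i < N and j < N. In the induction
    -- the norm of `g` is enlarged from N to N + 1 terms, after which the bound factors exactly.
    ‖‖-*ₛ : ∀ f g N → ‖ f *ₛ g ‖ r N ≤ ‖ f ‖ r N * ‖ g ‖ r N
    ‖‖-*ₛ f g zero    = ℚ.≤-reflexive (sym (ℚ.*-zeroˡ 0ℚ))
    ‖‖-*ₛ f g (suc N) = begin
      ∣ f 0 * g 0 + 0ℚ ∣ + r * ‖ f 0 · tail g +ₛ tail f *ₛ g ‖ r N
        ≤⟨ ℚ.+-mono-≤ (ℚ.≤-reflexive (trans (cong ∣_∣ (ℚ.+-identityʳ _)) (ℚ.∣p*q∣≡∣p∣*∣q∣ (f 0) (g 0))))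
             (r*-mono (ℚ.≤-trans (‖‖-+ₛ (f 0 · tail g) (tail f *ₛ g) N)
               (ℚ.+-mono-≤ (ℚ.≤-reflexive (‖‖-· (f 0) (tail g) N))
                 (ℚ.≤-trans (‖‖-*ₛ (tail f) g N)
                   (*-mono-≤-nonNeg (0≤‖‖ (tail f) N) ℚ.≤-refl (0≤‖‖ g N) (‖‖≤‖‖-suc g N)))))) ⟩
      ∣ f 0 ∣ * ∣ g 0 ∣ + r * (∣ f 0 ∣ * ‖ tail g ‖ r N + ‖ tail f ‖ r N * ‖ g ‖ r (suc N))
        ≡⟨ solve 5 (λ x y r u v → x :* y :+ r :* (x :* u :+ v :* (y :+ r :* u)) := (x :+ r :* v) :* (y :+ r :* u))
             refl ∣ f 0 ∣ ∣ g 0 ∣ r (‖ tail g ‖ r N) (‖ tail f ‖ r N) ⟩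
      ‖ f ‖ r (suc N) * ‖ g ‖ r (suc N) ∎

    -- A factor x yields a factor r and also shortens the truncation by one; the induction for
    -- `‖y‖≤K` lives on both.
    ‖X·‖ : ∀ f N → ‖ X· f ‖ r (suc N) ≡ r * ‖ f ‖ r N
    ‖X·‖ f N = ℚ.+-identityˡ _

    module _ (r≤1 : r ≤ 1ℚ) where
      r*p≤p : ∀ {p} → 0ℚ ≤ p → r * p ≤ p
      r*p≤p {p} 0≤p = ℚ.≤-trans (*-mono-≤-nonNeg 0≤r r≤1 0≤p ℚ.≤-refl) (ℚ.≤-reflexive (ℚ.*-identityˡ p))

      ‖X·‖≤ : ∀ f N → ‖ X· f ‖ r N ≤ ‖ f ‖ r N
      ‖X·‖≤ f zero    = ℚ.≤-refl
      ‖X·‖≤ f (suc N) = begin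
        ‖ X· f ‖ r (suc N)  ≡⟨ ‖X·‖ f N ⟩
        r * ‖ f ‖ r N       ≤⟨ r*p≤p (0≤‖‖ f N) ⟩
        ‖ f ‖ r N           ≤⟨ ‖‖≤‖‖-suc f N ⟩
        ‖ f ‖ r (suc N)     ∎

      ‖X^·‖≤ : ∀ k f N → ‖ X^ k · f ‖ r N ≤ ‖ f ‖ r N
      ‖X^·‖≤ zero    f N = ℚ.≤-refl
      ‖X^·‖≤ (suc k) f N = ℚ.≤-trans (‖X·‖≤ (X^ k · f) N) (‖X^·‖≤ k f N)

      -- Bounds at radius 1 hold for every smaller r, so they can be fixed before r is chosen.
      ‖‖-mono-r : ∀ f N → ‖ f ‖ r N ≤ ‖ f ‖ 1ℚ N
      ‖‖-mono-r f zero    = ℚ.≤-refl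
      ‖‖-mono-r f (suc N) = ℚ.+-monoʳ-≤ ∣ f 0 ∣
        (*-mono-≤-nonNeg 0≤r r≤1 (0≤‖‖ (tail f) N) (‖‖-mono-r (tail f) N))

  -- Absolutely summable series

  -- Bounded partial sums stand in for convergence, since the limit need not be rational. The class
  -- contains the polynomials and is closed under all operations below without any account of
  -- degrees.
  Summable : Series → Set
  Summable f = ∃[ B ] ∀ N → ‖ f ‖ 1ℚ N ≤ B

  0≤1 : 0ℚ ≤ 1ℚ
  0≤1 = ℚ.nonNegative⁻¹ 1ℚ

  summable-0ₛ : Summable 0ₛ
  summable-0ₛ = 0ℚ , ‖0‖
    where
    ‖0‖ : ∀ N → ‖ 0ₛ ‖ 1ℚ N ≤ 0ℚ
    ‖0‖ zero    = ℚ.≤-refl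
    ‖0‖ (suc N) = ℚ.+-mono-≤ (ℚ.≤-refl {0ℚ}) (ℚ.≤-trans (ℚ.≤-reflexive (ℚ.*-identityˡ _)) (‖0‖ N))

  summable-+ₛ : ∀ {f g} → Summable f → Summable g → Summable (f +ₛ g)
  summable-+ₛ {f} {g} (B , f≤) (C , g≤) = B + C , λ N →
    ℚ.≤-trans (‖‖-+ₛ 0≤1 f g N) (ℚ.+-mono-≤ (f≤ N) (g≤ N))

  summable-*ₛ : ∀ {f g} → Summable f → Summable g → Summable (f *ₛ g)
  summable-*ₛ {f} {g} (B , f≤) (C , g≤) = B * C , λ N →
    ℚ.≤-trans (‖‖-*ₛ 0≤1 f g N) (*-mono-≤-nonNeg (0≤‖‖ 0≤1 f N) (f≤ N) (0≤‖‖ 0≤1 g N) (g≤ N))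

  summable-tail⁺ : ∀ {f} → Summable (tail f) → Summable f
  summable-tail⁺ {f} (B , f≤) = ∣ f 0 ∣ + B , bound
    where
    bound : ∀ N → ‖ f ‖ 1ℚ N ≤ ∣ f 0 ∣ + B
    bound zero    = ℚ.+-mono-≤ (ℚ.0≤∣p∣ (f 0)) (f≤ 0)
    bound (suc N) = ℚ.+-monoʳ-≤ ∣ f 0 ∣ (ℚ.≤-trans (ℚ.≤-reflexive (ℚ.*-identityˡ _)) (f≤ N))

  summable-tail : ∀ {f} → Summable f → Summable (tail f)
  summable-tail {f} (B , f≤) = B , λ N → ℚ.≤-trans (‖tail‖≤ N) (f≤ (suc N))
    where
    ‖tail‖≤ : ∀ N → ‖ tail f ‖ 1ℚ N ≤ ‖ f ‖ 1ℚ (suc N)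
    ‖tail‖≤ N = ℚ.≤-trans (ℚ.≤-reflexive (trans (sym (ℚ.*-identityˡ _)) (sym (ℚ.+-identityˡ _))))
      (ℚ.+-monoˡ-≤ (1ℚ * ‖ tail f ‖ 1ℚ N) (ℚ.0≤∣p∣ (f 0)))

  summable-drop : ∀ k {f} → Summable f → Summable (drop k f)
  summable-drop zero    f-sum = f-sum
  summable-drop (suc k) f-sum = summable-drop k (summable-tail f-sum)

  summable-truncate : ∀ k f → Summable (truncate k f)
  summable-truncate zero    f = summable-0ₛ
  summable-truncate (suc k) f = summable-tail⁺ (summable-truncate k (tail f))

  summable-⟦⟧ : ∀ p → Summable ⟦ p ⟧
  summable-⟦⟧ []      = summable-0ₛ
  summable-⟦⟧ (c ∷ p) = summable-tail⁺ (summable-⟦⟧ p)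

  summable-eval : ∀ {n} {p : Vector Series n} {f} → (∀ i → Summable (p i)) → Summable f → Summable (eval p f)
  summable-eval {zero}  p-sum f-sum = summable-0ₛ
  summable-eval {suc n} p-sum f-sum =
    summable-+ₛ (p-sum zero) (summable-*ₛ f-sum (summable-eval (p-sum ∘ suc) f-sum))

  summable-eval′ : ∀ {n} {p : Vector Series n} {f} → (∀ i → Summable (p i)) → Summable f → Summable (eval′ p f)
  summable-eval′ {zero}  p-sum f-sum = summable-0ₛ
  summable-eval′ {suc n} p-sum f-sum =
    summable-+ₛ (summable-eval (p-sum ∘ suc) f-sum) (summable-*ₛ f-sum (summable-eval′ (p-sum ∘ suc) f-sum))

  -- The embedding of ℕ in ℚ

  -- The field 0 encodes the denominator 1. `ι` normalises its fraction, so its laws are proved for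
  -- these unnormalised ones and carried back.
  fromℕᵘ : ℕ → ℚᵘ.ℚᵘ
  fromℕᵘ n = ℚᵘ.mkℚᵘ (ℤ.+ n) 0

  -- Written so that `F n` is `ι (a n)` by computation.
  ι : ℕ → ℚ
  ι n = ℤ.+ n ℚ./ 1

  toℚᵘ-ι : ∀ n → ℚ.toℚᵘ (ι n) ℚᵘ.≃ fromℕᵘ n
  toℚᵘ-ι n = ℚ.toℚᵘ-fromℚᵘ (fromℕᵘ n)

  ι-* : ∀ m n → ι (m ℕ.* n) ≡ ι m * ι n
  ι-* m n = ℚ.toℚᵘ-injective (begin
    ℚ.toℚᵘ (ι (m ℕ.* n))               ≈⟨ toℚᵘ-ι (m ℕ.* n) ⟩
    fromℕᵘ (m ℕ.* n)                   ≈⟨ ℚᵘ.*≡* (cong (ℤ._* ℤ.1ℤ) (ℤ.pos-* m n)) ⟩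
    fromℕᵘ m ℚᵘ.* fromℕᵘ n             ≈⟨ ℚᵘ.*-cong (toℚᵘ-ι m) (toℚᵘ-ι n) ⟨
    ℚ.toℚᵘ (ι m) ℚᵘ.* ℚ.toℚᵘ (ι n)     ≈⟨ ℚ.toℚᵘ-homo-* (ι m) (ι n) ⟨
    ℚ.toℚᵘ (ι m * ι n)                 ∎)
    where open import Relation.Binary.Reasoning.Setoid ℚᵘ.≃-setoid

  ι-+ : ∀ m n → ι (m ℕ.+ n) ≡ ι m + ι n
  ι-+ m n = ℚ.toℚᵘ-injective (begin
    ℚ.toℚᵘ (ι (m ℕ.+ n))            ≈⟨ toℚᵘ-ι (m ℕ.+ n) ⟩
    fromℕᵘ (m ℕ.+ n)                ≈⟨ ℚᵘ.*≡* (cong (ℤ._* ℤ.1ℤ) (trans (ℤ.pos-+ m n)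
                                         (sym (cong₂ ℤ._+_ (ℤ.*-identityʳ (ℤ.+ m)) (ℤ.*-identityʳ (ℤ.+ n)))))) ⟩
    fromℕᵘ m ℚᵘ.+ fromℕᵘ n          ≈⟨ ℚᵘ.+-cong (toℚᵘ-ι m) (toℚᵘ-ι n) ⟨
    ℚ.toℚᵘ (ι m) ℚᵘ.+ ℚ.toℚᵘ (ι n)  ≈⟨ ℚ.toℚᵘ-homo-+ (ι m) (ι n) ⟨
    ℚ.toℚᵘ (ι m + ι n)              ∎)
    where open import Relation.Binary.Reasoning.Setoid ℚᵘ.≃-setoid

  ι-mono-≤ : ∀ {m n} → m ℕ.≤ n → ι m ≤ ι n
  ι-mono-≤ {m} {n} m≤n = ℚ.toℚᵘ-cancel-≤ (ℚᵘ.≤-respˡ-≃ (ℚᵘ.≃-sym (toℚᵘ-ι m))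
    (ℚᵘ.≤-respʳ-≃ (ℚᵘ.≃-sym (toℚᵘ-ι n)) (ℚᵘ.*≤* (ℤ.*-monoʳ-≤-nonNeg ℤ.1ℤ (ℤ.+≤+ m≤n)))))

  ι-cancel-≤ : ∀ {m n} → ι m ≤ ι n → m ℕ.≤ n
  ι-cancel-≤ {m} {n} ιm≤ιn
    with ℚᵘ.*≤* m*1≤n*1 ← ℚᵘ.≤-respˡ-≃ (toℚᵘ-ι m) (ℚᵘ.≤-respʳ-≃ (toℚᵘ-ι n) (ℚ.toℚᵘ-mono-≤ ιm≤ιn))
    = ℤ.drop‿+≤+ (ℤ.*-cancelʳ-≤-pos (ℤ.+ m) (ℤ.+ n) ℤ.1ℤ m*1≤n*1)

  0≤ι : ∀ n → 0ℚ ≤ ι n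
  0≤ι n = ι-mono-≤ {0} {n} z≤n

  -- The denominator is at least 1, so the absolute value of the numerator is large enough. The
  -- successor makes the bound invertible.
  archimedean : ∀ q → ∃[ n ] q ≤ ι (suc n)
  archimedean q@(ℚ.mkℚ num den-1 _) = ℤ.∣ num ∣ , ℚ.toℚᵘ-cancel-≤
    (ℚᵘ.≤-respʳ-≃ (ℚᵘ.≃-sym (toℚᵘ-ι (suc ℤ.∣ num ∣))) (ℚᵘ.*≤* (begin
      num ℤ.* ℤ.1ℤ                                ≡⟨ ℤ.*-identityʳ num ⟩
      num                                         ≤⟨ i≤∣i∣ num ⟩
      ℤ.+ ℤ.∣ num ∣                               ≤⟨ ℤ.+≤+ (ℕ.≤-trans (ℕ.n≤1+n _) (ℕ.m≤m*n (suc ℤ.∣ num ∣) (suc den-1))) ⟩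
      ℤ.+ (suc ℤ.∣ num ∣ ℕ.* suc den-1)           ≡⟨ ℤ.pos-* (suc ℤ.∣ num ∣) (suc den-1) ⟩
      ℤ.+ suc ℤ.∣ num ∣ ℤ.* ℤ.+ suc den-1         ∎)))
    where
    open ℤ.≤-Reasoning
    i≤∣i∣ : ∀ i → i ℤ.≤ ℤ.+ ℤ.∣ i ∣
    i≤∣i∣ (ℤ.+ n)      = ℤ.≤-refl
    i≤∣i∣ ℤ.-[1+ n ]   = ℤ.-≤+

  ι-suc≢0 : ∀ n → ι (suc n) ≢ 0ℚ
  ι-suc≢0 n ι≡0 with () ← ι-cancel-≤ {suc n} {0} (ℚ.≤-reflexive ι≡0)

  ι-suc-inverse : ∀ n → ∃[ r ] 0ℚ ≤ r × r ≤ 1ℚ × r * ι (suc n) ≡ 1ℚ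
  ι-suc-inverse n = r , 0≤r , r≤1 , r*M≡1
    where
    instance _ = ℚ.≢-nonZero (ι-suc≢0 n)
    instance _ = ℚ.nonNeg∧nonZero⇒pos (ι (suc n)) {{ℚ.nonNegative (0≤ι (suc n))}}
    r : ℚ
    r = ℚ.1/ ι (suc n)
    r*M≡1 : r * ι (suc n) ≡ 1ℚ
    r*M≡1 = ℚ.*-inverseˡ (ι (suc n))
    0≤r : 0ℚ ≤ r
    0≤r = ℚ.<⇒≤ (ℚ.positive⁻¹ r {{ℚ.1/pos⇒pos (ι (suc n))}})
    r≤1 : r ≤ 1ℚ
    r≤1 = subst (_≤ 1ℚ) (ℚ.*-identityʳ r)
      (ℚ.≤-trans (ℚ.*-monoˡ-≤-nonNeg r {{ℚ.nonNegative 0≤r}} (ι-mono-≤ {1} {suc n} (s≤s z≤n))) (ℚ.≤-reflexive r*M≡1))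

  -- Exponential bounds for the coefficients of algebraic series

  -- |fₙ| rⁿ is one of the terms of the norm, and Mⁿ cancels rⁿ.
  ∣coefficient∣≤‖‖ : ∀ {r} M → 0ℚ ≤ r → r * ι M ≡ 1ℚ →
                      ∀ f n → ∣ f n ∣ ≤ ‖ f ‖ r (suc n) * ι (M ℕ.^ n)
  ∣coefficient∣≤‖‖ {r} M 0≤r r*M≡1 f zero = ℚ.≤-reflexive
    (solve 2 (λ x r → x := (x :+ r :* con 0ℚ) :* con 1ℚ) refl ∣ f 0 ∣ r)
  ∣coefficient∣≤‖‖ {r} M 0≤r r*M≡1 f (suc n) = begin
    ∣ f (suc n) ∣
      ≤⟨ ∣coefficient∣≤‖‖ M 0≤r r*M≡1 (tail f) n ⟩
    y * m
      ≡⟨ ℚ.*-identityˡ (y * m) ⟨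
    1ℚ * (y * m)
      ≡⟨ cong (_* (y * m)) r*M≡1 ⟨
    r * ι M * (y * m)
      ≡⟨ solve 4 (λ r M y m → r :* M :* (y :* m) := (con 0ℚ :+ r :* y) :* (M :* m)) refl r (ι M) y m ⟩
    (0ℚ + r * y) * (ι M * m)
      ≤⟨ *-mono-≤-nonNeg (ℚ.≤-trans (0≤p*q 0≤r (0≤‖‖ 0≤r (tail f) (suc n))) (ℚ.≤-reflexive (sym (ℚ.+-identityˡ (r * y)))))
           (ℚ.+-monoˡ-≤ (r * y) (ℚ.0≤∣p∣ (f 0)))
           (0≤p*q (0≤ι M) (0≤ι (M ℕ.^ n))) ℚ.≤-refl ⟩
    ‖ f ‖ r (suc (suc n)) * (ι M * m)
      ≡⟨ cong (‖ f ‖ r (suc (suc n)) *_) (ι-* M (M ℕ.^ n)) ⟨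
    ‖ f ‖ r (suc (suc n)) * ι (M ℕ.^ suc n) ∎
    where
    open ℚ.≤-Reasoning
    y m : ℚ
    y = ‖ tail f ‖ r (suc n)
    m = ι (M ℕ.^ n)

  -- The order of quantifiers matters: B depends on K but on neither r nor N, because r is later
  -- chosen in terms of B.
  remainder-bounded : ∀ {n} {p : Vector Series n} {t} → (∀ i → Summable (p i)) → Summable t →
                      ∀ K → ∃[ B ] (∀ {r} → 0ℚ ≤ r → r ≤ 1ℚ → ∀ f N → ‖ f ‖ r N ≤ K →
                                    ‖ remainder p t f ‖ r N ≤ B)
  remainder-bounded {zero}  p-sum t-sum K = 0ℚ , λ 0≤r r≤1 f N f≤ →
    ℚ.≤-trans (‖‖-mono-r 0≤r r≤1 0ₛ N) (proj₂ summable-0ₛ N)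
  remainder-bounded {suc n} {p} {t} p-sum t-sum K
    with D , d≤ ← summable-eval′ (p-sum ∘ suc) t-sum
       | B , bound ← remainder-bounded (p-sum ∘ suc) t-sum K
    = D + K * B , λ {r} 0≤r r≤1 f N f≤ → ℚ.≤-trans
        (‖‖-+ₛ 0≤r (eval′ (p ∘ suc) t) (f *ₛ remainder (p ∘ suc) t f) N)
        (ℚ.+-mono-≤ (ℚ.≤-trans (‖‖-mono-r 0≤r r≤1 (eval′ (p ∘ suc) t) N) (d≤ N))
          (ℚ.≤-trans (‖‖-*ₛ 0≤r f (remainder (p ∘ suc) t f) N)
            (*-mono-≤-nonNeg (0≤‖‖ 0≤r f N) f≤ (0≤‖‖ 0≤r (remainder (p ∘ suc) t f) N) (bound 0≤r r≤1 f N f≤))))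

  ∣∣-of-opposites : ∀ {x y} → x + y ≡ 0ℚ → ∣ x ∣ ≡ ∣ y ∣
  ∣∣-of-opposites {x} {y} x+y≡0 =
    trans (cong ∣_∣ (GroupProperties.inverseˡ-unique ℚ.+-0-group x y x+y≡0)) (ℚ.∣-p∣≡∣p∣ y)

  -- Isolates u₀ y inside the product y u; the rest has a factor x. After commuting the factors it
  -- holds by computation.
  *ₛ-unfoldʳ : ∀ f g → f *ₛ g ≗ g 0 · f +ₛ X· (tail g *ₛ f)
  *ₛ-unfoldʳ f g zero    = *ₛ-comm f g 0
  *ₛ-unfoldʳ f g (suc n) = *ₛ-comm f g (suc n)

  -- Growth of f when p′(f) has finite order s

  module SimpleRoot {m} (p : Vector Series m) (p-summable : ∀ i → Summable (p i))
    (f : Series) (p[f]≗0 : eval p f ≗ 0ₛ)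
    (s : ℕ) (p′[f]<s : ∀ i → i ℕ.< s → eval′ p f i ≡ 0ℚ) (p′[f]ₛ≢0 : eval′ p f s ≢ 0ℚ)
    where

    -- With h = x^(s+1) y and d = x^s u, the expansion p(t) + h d + h² R = 0 divided by x^(2s+1)
    -- reads q + y u + x y² R = 0. Splitting u = u₀ + x `tail u` gives u₀ y + q + x w = 0.
    t y h d u q R w : Series
    t = truncate (suc s) f
    y = drop (suc s) f
    h = X^ suc s · y
    d = eval′ p t
    u = drop s d
    q = drop s (drop (suc s) (eval p t))
    R = remainder p t f
    w = tail u *ₛ y +ₛ y *ₛ (y *ₛ R)

    -- t keeps the coefficients of index at most s, so p′(t) agrees with p′(f) through the first
    -- nonzero coefficient.
    d≤s : ∀ {i} → i ℕ.≤ s → d i ≡ eval′ p f i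
    d≤s = eval′-cong-≤ p s (λ i≤s → truncate-< (suc s) f (s≤s i≤s))

    d≗X^s·u : d ≗ X^ s · u
    d≗X^s·u = X^·-drop s d (λ i i<s → trans (d≤s (ℕ.<⇒≤ i<s)) (p′[f]<s i i<s))

    u₀≢0 : u 0 ≢ 0ℚ
    u₀≢0 u₀≡0 = p′[f]ₛ≢0 (trans (sym (d≤s ℕ.≤-refl)) (trans (sym (drop-at s d 0)) u₀≡0))

    h*d : h *ₛ d ≗ X^ suc s · (X^ s · (y *ₛ u))
    h*d n = trans (*ₛ-cong {h} (λ _ → refl) d≗X^s·u n) (trans (X^·-*ₛ (suc s) y (X^ s · u) n)
      (X^·-cong (suc s) (*ₛ-X^· s y u) n))

    -- h² contains x^(2s+2), one factor x more than h d. This spare factor delays the nonlinear term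
    -- in the recursion.
    h*h*R : h *ₛ h *ₛ R ≗ X^ suc s · (X^ s · (X· (y *ₛ (y *ₛ R))))
    h*h*R n = trans (*ₛ-assoc h h R n) (trans (X^·-*ₛ (suc s) y (h *ₛ R) n) (X^·-cong (suc s) (λ n →
      trans (*ₛ-cong {y} (λ _ → refl) (X^·-*ₛ (suc s) y R) n)
        (trans (*ₛ-X^· (suc s) y (y *ₛ R) n) (X·-X^· s (y *ₛ (y *ₛ R)) n))) n))

    -- Drop the first 2s+1 coefficients on both sides of the Taylor expansion; `drop` is additive,
    -- whatever the dropped coefficients of p(t) are.
    u₀·y+q+X·w≡0 : ∀ n → u 0 * y n + (q n + (X· w) n) ≡ 0ℚ
    u₀·y+q+X·w≡0 n = begin
      u 0 * y n + (q n + (X· w) n)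
        ≡⟨ cong (λ x → u 0 * y n + (q n + x)) (X·-+ₛ (tail u *ₛ y) (y *ₛ (y *ₛ R)) n) ⟨
      u 0 * y n + (q n + ((X· (tail u *ₛ y)) n + (X· (y *ₛ (y *ₛ R))) n))
        ≡⟨ solve 4 (λ a b c d → a :+ (b :+ (c :+ d)) := b :+ ((a :+ c) :+ d)) refl (u 0 * y n) (q n) _ _ ⟩
      q n + ((u 0 * y n + (X· (tail u *ₛ y)) n) + (X· (y *ₛ (y *ₛ R))) n)
        ≡⟨ cong (λ x → q n + (x + (X· (y *ₛ (y *ₛ R))) n)) (*ₛ-unfoldʳ y u n) ⟨
      q n + v n
        ≡⟨ cong (q n +_) (trans (cong (λ g → drop s g n) (drop-X^· (suc s) (X^ s · v))) (cong (λ g → g n) (drop-X^· s v))) ⟨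
      q n + drop s (drop (suc s) (X^ suc s · (X^ s · v))) n
        ≡⟨ drop-+ₛ s (drop (suc s) (eval p t)) (drop (suc s) (X^ suc s · (X^ s · v))) n ⟨
      drop s (drop (suc s) (eval p t) +ₛ drop (suc s) (X^ suc s · (X^ s · v))) n
        ≡⟨ drop-cong s (drop-+ₛ (suc s) (eval p t) (X^ suc s · (X^ s · v))) n ⟨
      drop s (drop (suc s) (eval p t +ₛ X^ suc s · (X^ s · v))) n
        ≡⟨ drop-cong s (drop-cong (suc s) p[t]+X^v≗0) n ⟩
      drop s (drop (suc s) 0ₛ) n
        ≡⟨ trans (drop-at s (drop (suc s) 0ₛ) n) (drop-at (suc s) 0ₛ (n ℕ.+ s)) ⟩
      0ℚ ∎
      where
      open ≡-Reasoning
      v : Series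
      v = y *ₛ u +ₛ X· (y *ₛ (y *ₛ R))

      p[t]+X^v≗0 : eval p t +ₛ X^ suc s · (X^ s · v) ≗ 0ₛ
      p[t]+X^v≗0 n = begin
        eval p t n + (X^ suc s · (X^ s · v)) n
          ≡⟨ cong (eval p t n +_) (X^·-cong (suc s) (X^·-+ₛ s (y *ₛ u) (X· (y *ₛ (y *ₛ R)))) n) ⟨
        eval p t n + (X^ suc s · (X^ s · (y *ₛ u) +ₛ X^ s · (X· (y *ₛ (y *ₛ R))))) n
          ≡⟨ cong (eval p t n +_) (X^·-+ₛ (suc s) (X^ s · (y *ₛ u)) (X^ s · (X· (y *ₛ (y *ₛ R)))) n) ⟨
        eval p t n + ((X^ suc s · (X^ s · (y *ₛ u))) n + (X^ suc s · (X^ s · (X· (y *ₛ (y *ₛ R))))) n)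
          ≡⟨ cong₂ (λ a b → eval p t n + (a + b)) (h*d n) (h*h*R n) ⟨
        eval p t n + ((h *ₛ d) n + (h *ₛ h *ₛ R) n)
          ≡⟨ taylor p (truncate+X^·drop (suc s) f) n ⟨
        eval p f n
          ≡⟨ p[f]≗0 n ⟩
        0ℚ ∎

    -- Constants in order of choice: Q, U and T bound q, `tail u` and t at radius 1; K is to bound
    -- y, B then bounds R and W bounds w; only then is r fixed.
    exponentiallyBounded : ∃[ K ] ∃[ M ] ∀ n → ∣ f (n ℕ.+ suc s) ∣ ≤ ι (K ℕ.* suc M ℕ.^ n)
    exponentiallyBounded
      with Q , q≤ ← summable-drop s (summable-drop (suc s) (summable-eval p-summable (summable-truncate (suc s) f)))
         | U , u≤ ← summable-tail (summable-drop s (summable-eval′ p-summable (summable-truncate (suc s) f)))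
         | T , t≤ ← summable-truncate (suc s) f
      = suc K′ , M , λ n → begin
          ∣ f (n ℕ.+ suc s) ∣                ≡⟨ cong ∣_∣ (drop-at (suc s) f n) ⟨
          ∣ y n ∣                            ≤⟨ ∣coefficient∣≤‖‖ (suc M) 0≤r r*M≡1 y n ⟩
          ‖ y ‖ r (suc n) * ι (suc M ℕ.^ n)
            ≤⟨ *-mono-≤-nonNeg (0≤‖‖ 0≤r y (suc n)) (ℚ.≤-trans (‖y‖≤K (suc n)) K≤K′) (0≤ι (suc M ℕ.^ n)) ℚ.≤-refl ⟩
          ι (suc K′) * ι (suc M ℕ.^ n)       ≡⟨ ι-* (suc K′) (suc M ℕ.^ n) ⟨
          ι (suc K′ ℕ.* suc M ℕ.^ n)         ∎
      where
      open ℚ.≤-Reasoning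
      instance _ = ℚ.≢-nonZero u₀≢0

      α K B W : ℚ
      α = ∣ ℚ.1/ u 0 ∣
      -- The summand 1 leaves room for r times the norm of w.
      K = α * (Q + 1ℚ)
      K′ = proj₁ (archimedean K)
      K≤K′ = proj₂ (archimedean K)
      -- R is evaluated at f = t + x^(s+1) y, whose norm is at most T + K for r ≤ 1.
      bound = remainder-bounded p-summable (summable-truncate (suc s) f) (T + K)
      B = proj₁ bound
      W = U * K + K * (K * B)
      -- W ≤ M + 1 and r = 1/(M + 1), hence r W ≤ 1.
      M = proj₁ (archimedean W)
      r = proj₁ (ι-suc-inverse M)
      0≤r = proj₁ (proj₂ (ι-suc-inverse M))
      r≤1 = proj₁ (proj₂ (proj₂ (ι-suc-inverse M)))
      r*M≡1 = proj₂ (proj₂ (proj₂ (ι-suc-inverse M)))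

      0≤α : 0ℚ ≤ α
      0≤α = ℚ.0≤∣p∣ (ℚ.1/ u 0)

      α*∣u₀∣≡1 : α * ∣ u 0 ∣ ≡ 1ℚ
      α*∣u₀∣≡1 = trans (sym (ℚ.∣p*q∣≡∣p∣*∣q∣ (ℚ.1/ u 0) (u 0))) (cong ∣_∣ (ℚ.*-inverseˡ (u 0)))

      ‖f‖≤ : ∀ N → ‖ y ‖ r N ≤ K → ‖ f ‖ r N ≤ T + K
      ‖f‖≤ N y≤ = begin
        ‖ f ‖ r N               ≡⟨ ‖‖-cong-∣∣ (λ n → cong ∣_∣ (truncate+X^·drop (suc s) f n)) r N ⟩
        ‖ t +ₛ h ‖ r N          ≤⟨ ‖‖-+ₛ 0≤r t h N ⟩
        ‖ t ‖ r N + ‖ h ‖ r N   ≤⟨ ℚ.+-mono-≤ (ℚ.≤-trans (‖‖-mono-r 0≤r r≤1 t N) (t≤ N))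
                                    (ℚ.≤-trans (‖X^·‖≤ 0≤r r≤1 (suc s) y N) y≤) ⟩
        T + K                   ∎

      ‖w‖≤W : ∀ N → ‖ y ‖ r N ≤ K → ‖ w ‖ r N ≤ W
      ‖w‖≤W N y≤ = begin
        ‖ w ‖ r N
          ≤⟨ ‖‖-+ₛ 0≤r (tail u *ₛ y) (y *ₛ (y *ₛ R)) N ⟩
        ‖ tail u *ₛ y ‖ r N + ‖ y *ₛ (y *ₛ R) ‖ r N
          ≤⟨ ℚ.+-mono-≤ (product≤ (tail u) y (ℚ.≤-trans (‖‖-mono-r 0≤r r≤1 (tail u) N) (u≤ N)) y≤)
               (product≤ y (y *ₛ R) y≤ (product≤ y R y≤ (proj₂ bound 0≤r r≤1 f N (‖f‖≤ N y≤)))) ⟩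
        W ∎
        where
        product≤ : ∀ g g′ {C C′} → ‖ g ‖ r N ≤ C → ‖ g′ ‖ r N ≤ C′ → ‖ g *ₛ g′ ‖ r N ≤ C * C′
        product≤ g g′ g≤ g′≤ =
          ℚ.≤-trans (‖‖-*ₛ 0≤r g g′ N) (*-mono-≤-nonNeg (0≤‖‖ 0≤r g N) g≤ (0≤‖‖ 0≤r g′ N) g′≤)

      -- Divide the recursion by u₀. Because of the factor x, N + 1 terms of y involve only N terms
      -- of w, which the induction hypothesis bounds by W.
      ‖y‖≤K : ∀ N → ‖ y ‖ r N ≤ K
      ‖y‖≤K zero    = 0≤p*q 0≤α (ℚ.+-mono-≤ (q≤ 0) 0≤1)
      ‖y‖≤K (suc N) = begin
        ‖ y ‖ r (suc N)                            ≡⟨ ℚ.*-identityˡ _ ⟨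
        1ℚ * ‖ y ‖ r (suc N)                       ≡⟨ cong (_* ‖ y ‖ r (suc N)) α*∣u₀∣≡1 ⟨
        α * ∣ u 0 ∣ * ‖ y ‖ r (suc N)              ≡⟨ ℚ.*-assoc α ∣ u 0 ∣ _ ⟩
        α * (∣ u 0 ∣ * ‖ y ‖ r (suc N))            ≡⟨ cong (α *_) (‖‖-· 0≤r (u 0) y (suc N)) ⟨
        α * ‖ u 0 · y ‖ r (suc N)                  ≡⟨ cong (α *_) (‖‖-cong-∣∣ {u 0 · y} {q +ₛ X· w} (∣∣-of-opposites ∘ u₀·y+q+X·w≡0) r (suc N)) ⟩
        α * ‖ q +ₛ X· w ‖ r (suc N)                ≤⟨ α*-mono (‖‖-+ₛ 0≤r q (X· w) (suc N)) ⟩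
        α * (‖ q ‖ r (suc N) + ‖ X· w ‖ r (suc N)) ≡⟨ cong (λ x → α * (‖ q ‖ r (suc N) + x)) (‖X·‖ 0≤r w N) ⟩
        α * (‖ q ‖ r (suc N) + r * ‖ w ‖ r N)
          ≤⟨ α*-mono (ℚ.+-mono-≤ (ℚ.≤-trans (‖‖-mono-r 0≤r r≤1 q (suc N)) (q≤ (suc N)))
               (r*-mono 0≤r (ℚ.≤-trans (‖w‖≤W N (‖y‖≤K N)) (proj₂ (archimedean W))))) ⟩
        α * (Q + r * ι (suc M))                    ≡⟨ cong (λ x → α * (Q + x)) r*M≡1 ⟩
        K                                          ∎
        where
        α*-mono : ∀ {x y} → x ≤ y → α * x ≤ α * y
        α*-mono = ℚ.*-monoˡ-≤-nonNeg α {{ℚ.nonNegative 0≤α}}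

  -- Algebraic series

  ×ₛ≗ι· : ∀ k f → k ×ₛ f ≗ ι k · f
  ×ₛ≗ι· zero    f n = sym (ℚ.*-zeroˡ (f n))
  ×ₛ≗ι· (suc k) f n = begin
    f n + (k ×ₛ f) n     ≡⟨ cong (f n +_) (×ₛ≗ι· k f n) ⟩
    f n + ι k * f n      ≡⟨ solve 2 (λ x k → x :+ k :* x := (con 1ℚ :+ k) :* x) refl (f n) (ι k) ⟩
    (1ℚ + ι k) * f n     ≡⟨ cong (_* f n) (ι-+ 1 k) ⟨
    ι (suc k) * f n      ∎
    where open ≡-Reasoning

  -- Characteristic zero enters here: it keeps the leading coefficient of a derivative nonzero.
  ×ₛ-torsionFree : ∀ k f → suc k ×ₛ f ≗ 0ₛ → f ≗ 0ₛ
  ×ₛ-torsionFree k f kf≗0 n = begin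
    f n                          ≡⟨ ℚ.*-identityˡ (f n) ⟨
    1ℚ * f n                     ≡⟨ cong (_* f n) r*k≡1 ⟨
    r * ι (suc k) * f n          ≡⟨ ℚ.*-assoc r (ι (suc k)) (f n) ⟩
    r * (ι (suc k) * f n)        ≡⟨ cong (r *_) (trans (sym (×ₛ≗ι· (suc k) f n)) (kf≗0 n)) ⟩
    r * 0ℚ                       ≡⟨ ℚ.*-zeroʳ r ⟩
    0ℚ                           ∎
    where
    open ≡-Reasoning
    r = proj₁ (ι-suc-inverse k)
    r*k≡1 = proj₂ (proj₂ (proj₂ (ι-suc-inverse k)))

  weighted-≗0 : ∀ {n} k (p : Vector Series n) i → weighted (suc k) p i ≗ 0ₛ → p i ≗ 0ₛ
  weighted-≗0 k p zero    = ×ₛ-torsionFree k (p zero)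
  weighted-≗0 k p (suc i) = weighted-≗0 (suc k) (p ∘ suc) i

  summable-×ₛ : ∀ k {f} → Summable f → Summable (k ×ₛ f)
  summable-×ₛ zero    f-sum = summable-0ₛ
  summable-×ₛ (suc k) f-sum = summable-+ₛ f-sum (summable-×ₛ k f-sum)

  summable-weighted : ∀ {n} k {p : Vector Series n} → (∀ i → Summable (p i)) → ∀ i → Summable (weighted k p i)
  summable-weighted k p-sum zero    = summable-×ₛ k (p-sum zero)
  summable-weighted k p-sum (suc i) = summable-weighted (suc k) (p-sum ∘ suc) i

  -- A search for the first nonzero coefficient need not end, so only its absence is used. Equality
  -- in ℚ is decidable, and a nonzero coefficient preceded by zeros would be the first one; strong
  -- induction concludes.
  noFirstNonzero⇒≗0 : ∀ f → ¬ (∃[ s ] (∀ i → i ℕ.< s → f i ≡ 0ℚ) × f s ≢ 0ℚ) → f ≗ 0ₛ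
  noFirstNonzero⇒≗0 f none n = below (suc n) n ℕ.≤-refl
    where
    below : ∀ n i → i ℕ.< n → f i ≡ 0ℚ
    below (suc n) i (s≤s i≤n) with f i ℚ.≟ 0ℚ
    ... | yes fi≡0 = fi≡0
    ... | no  fi≢0 = contradiction (i , (λ j j<i → below n j (ℕ.<-≤-trans j<i i≤n)) , fi≢0) none

  -- The bound is a natural number with a positive base, so that it can be compared with `a` inside
  -- ℕ.
  ExponentiallyBounded : Series → Set
  ExponentiallyBounded f = ∃[ s ] ∃[ K ] ∃[ M ] ∀ n → ∣ f (n ℕ.+ s) ∣ ≤ ι (K ℕ.* suc M ℕ.^ n)

  -- Whether p′(f) vanishes cannot be decided, hence the double negation. If f is unbounded, p′(f)
  -- can have no first nonzero coefficient, so p′(f) = 0 and the induction passes to p′, which again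
  -- has a nonzero leading coefficient. At degree 0 the equation says p₀ = 0.
  algebraic⇒exponentiallyBounded :
    ∀ m (p : Vector Series (suc m)) → (∀ i → Summable (p i)) → ¬ (p (fromℕ m) ≗ 0ₛ) →
    ∀ f → eval p f ≗ 0ₛ → ¬ ¬ ExponentiallyBounded f
  algebraic⇒exponentiallyBounded zero p p-sum pₘ≢0 f p[f]≗0 _ = pₘ≢0 λ n → begin
    p zero n                       ≡⟨ ℚ.+-identityʳ (p zero n) ⟨
    p zero n + 0ℚ                  ≡⟨ cong (p zero n +_) (S.zeroʳ f n) ⟨
    p zero n + (f *ₛ 0ₛ) n         ≡⟨ p[f]≗0 n ⟩
    0ℚ                             ∎
    where open ≡-Reasoning
  algebraic⇒exponentiallyBounded (suc m) p p-sum pₘ≢0 f p[f]≗0 unbounded =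
    algebraic⇒exponentiallyBounded m (derivative p) (summable-weighted 1 (p-sum ∘ suc))
      (pₘ≢0 ∘ weighted-≗0 0 (p ∘ suc) (fromℕ m)) f
      (λ n → trans (eval-derivative p f n) (p′[f]≗0 n)) unbounded
    where
    p′[f]≗0 : eval′ p f ≗ 0ₛ
    p′[f]≗0 = noFirstNonzero⇒≗0 (eval′ p f) λ (s , p′[f]<s , p′[f]ₛ≢0) →
      unbounded (suc s , SimpleRoot.exponentiallyBounded p p-sum f p[f]≗0 s p′[f]<s p′[f]ₛ≢0)

  -- Agreement of `evalAt` with Horner's scheme

  ^ₛ≗^ : ∀ f k → f ^ₛ k ≗ SemiringExp._^_ S.semiring f k
  ^ₛ≗^ f zero    n = refl
  ^ₛ≗^ f (suc k) = *ₛ-cong {f} (λ _ → refl) (^ₛ≗^ f k)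

  module ℚΣ = CommutativeMonoidSum ℚ.+-0-commutativeMonoid
  module SΣ = SemiringSum S.semiring

  sum-at : ∀ {n} (v : Vector Series n) i → SΣ.sum v i ≡ ℚΣ.sum (λ j → v j i)
  sum-at {zero}  v i = refl
  sum-at {suc n} v i = cong (v zero i +_) (sum-at (v ∘ suc) i)

  evalAt≗eval : ∀ {m} (p : Fin (suc m) → Poly) f → evalAt p f ≗ eval (⟦_⟧ ∘ p) f
  evalAt≗eval p f n = begin
    evalAt p f n
      ≡⟨ ℚΣ.sum-cong-≗ (λ j → *ₛ-cong {⟦ p j ⟧} (λ _ → refl) (^ₛ≗^ f (toℕ j)) n) ⟩
    ℚΣ.sum (λ j → (⟦ p j ⟧ *ₛ SemiringExp._^_ S.semiring f (toℕ j)) n)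
      ≡⟨ sum-at (λ j → ⟦ p j ⟧ *ₛ SemiringExp._^_ S.semiring f (toℕ j)) n ⟨
    SΣ.sum (λ j → ⟦ p j ⟧ *ₛ SemiringExp._^_ S.semiring f (toℕ j)) n
      ≡⟨ eval≈sum (⟦_⟧ ∘ p) f n ⟨
    eval (⟦_⟧ ∘ p) f n ∎
    where open ≡-Reasoning

open import Data.Nat using (NonZero; _+_; _*_; _∸_; _^_; _!; _≤_; _≥_; _<_; _>_; _<ᵇ_; _≟_)
open import Data.Nat.Properties using
  ( *-assoc; *-comm; *-mono-≤; *-monoʳ-≤; +-assoc; +-identityʳ; 1≤n!; <-asym; <ᵇ⇒<; <⇒<ᵇ; <⇒≢
  ; ^-*-assoc; ^-monoʳ-≤; ^-monoˡ-<; ^-monoˡ-≤; m∸n+n≡m; m∸n≤m; m≤m+n; m≤n+m; m≤n⇒m≤1+n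
  ; suc-injective; ≤-refl; ≤-reflexive; ≤-trans; module ≤-Reasoning )

-- Counting pop-stacked permutations

-- Delete one occurrence of the head of `xs` from `ys`; by distinctness the rest of `xs` stays
-- inside what is left.
Unique-⊆⇒length≤ : ∀ {A : Set} {xs ys : List A} → Unique xs → (∀ {x} → x ∈ xs → x ∈ ys) →
                   length xs ≤ length ys
Unique-⊆⇒length≤ []            xs⊆ys = z≤n
Unique-⊆⇒length≤ {xs = x ∷ xs} (x≢ ∷ xs!) xs⊆ys with as , bs , refl ← ∈-∃++ (xs⊆ys (here refl)) =
  ≤-trans (s≤s (Unique-⊆⇒length≤ xs! xs⊆)) (≤-reflexive (sym (length-++-sucʳ as x bs)))
  where
  xs⊆ : ∀ {y} → y ∈ xs → y ∈ as ++ bs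
  xs⊆ y∈ with ∈-++⁻ as (xs⊆ys (there y∈))
  ... | inj₁ y∈as          = ∈-++⁺ˡ y∈as
  ... | inj₂ (here refl)   = contradiction refl (All.lookup x≢ y∈)
  ... | inj₂ (there y∈bs)  = ∈-++⁺ʳ as y∈bs

concatMap-unique : ∀ {A B : Set} (f : A → List B) {xs} →
                   (∀ {x} → x ∈ xs → Unique (f x)) →
                   (∀ {x x′ y} → x ∈ xs → x′ ∈ xs → y ∈ f x → y ∈ f x′ → x ≡ x′) →
                   Unique xs → Unique (concatMap f xs)
concatMap-unique f f! f-disjoint []         = []
concatMap-unique f {x ∷ xs} f! f-disjoint (x≢ ∷ xs!) = Unique.++⁺ (f! (here refl))
  (concatMap-unique f (f! ∘ there) (λ x∈ x′∈ → f-disjoint (there x∈) (there x′∈)) xs!)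
  λ (y∈fx , y∈) → let x′ , x′∈ , y∈fx′ = find (∈-concatMap⁻ f {xs = xs} y∈) in
    All.lookup x≢ x′∈ (f-disjoint (here refl) (there x′∈) y∈fx y∈fx′)

length-concatMap : ∀ {A B : Set} (f : A → List B) {c xs} → All (λ x → length (f x) ≡ c) xs →
                   length (concatMap f xs) ≡ length xs * c
length-concatMap f []                  = refl
length-concatMap f {xs = x ∷ xs} (fx ∷ fxs) = trans (length-++ (f x)) (cong₂ _+_ fx (length-concatMap f fxs))

length-insertions : ∀ x xs → length (insertions x xs) ≡ suc (length xs)
length-insertions x []       = refl
length-insertions x (y ∷ xs) =
  cong suc (trans (length-map (y ∷_) (insertions x xs)) (length-insertions x xs))

insertions-unique : ∀ {x xs} → All (x ≢_) xs → Unique (insertions x xs)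
insertions-unique {x} []              = [] ∷ []
insertions-unique {x} {y ∷ xs} (x≢y ∷ x≢) =
  All.map⁺ (All.universal (λ _ → x≢y ∘ ∷-injectiveˡ) (insertions x xs)) ∷
  Unique.map⁺ ∷-injectiveʳ (insertions-unique x≢)

-- Deleting x undoes its insertion, so insertions into different words never coincide.
filter-insertions : ∀ {x xs σ} → All (x ≢_) xs → σ ∈ insertions x xs →
                    filter (λ y → ¬? (x ≟ y)) σ ≡ xs
filter-insertions {x} {[]} x≢ (here refl) = filter-reject (λ y → ¬? (x ≟ y)) (λ x≢x → x≢x refl)
filter-insertions {x} {y ∷ xs} x≢ (here refl) =
  trans (filter-reject (λ y → ¬? (x ≟ y)) (λ x≢x → x≢x refl)) (filter-all (λ y → ¬? (x ≟ y)) x≢)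
filter-insertions {x} {y ∷ xs} (x≢y ∷ x≢) (there σ∈) with _ , τ∈ , refl ← ∈-map⁻ (y ∷_) σ∈ =
  trans (filter-accept (λ y → ¬? (x ≟ y)) x≢y) (cong (y ∷_) (filter-insertions x≢ τ∈))

∈-permutations⁻ : ∀ xs {σ} → σ ∈ permutations xs → σ ↭ xs
∈-permutations⁻ xs = Equivalence.to (∈-permutations⇔ xs)

permutations-unique : ∀ {xs} → Unique xs → Unique (permutations xs)
permutations-unique [] = [] ∷ []
permutations-unique {x ∷ xs} (x≢ ∷ xs!) = concatMap-unique (insertions x)
  (insertions-unique ∘ x≢τ)
  (λ τ∈ τ′∈ σ∈ σ∈′ → trans (sym (filter-insertions (x≢τ τ∈) σ∈)) (filter-insertions (x≢τ τ′∈) σ∈′))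
  (permutations-unique xs!)
  where
  x≢τ : ∀ {τ} → τ ∈ permutations xs → All (x ≢_) τ
  x≢τ τ∈ = All-resp-↭ (↭-sym (∈-permutations⁻ xs τ∈)) x≢

length-permutations : ∀ xs → length (permutations xs) ≡ length xs !
length-permutations []       = refl
length-permutations (x ∷ xs) = begin
  length (concatMap (insertions x) (permutations xs))
    ≡⟨ length-concatMap (insertions x) (All.tabulate λ {τ} τ∈ →
         trans (length-insertions x τ) (cong suc (↭-length (∈-permutations⁻ xs τ∈)))) ⟩
  length (permutations xs) * suc (length xs)  ≡⟨ cong (_* suc (length xs)) (length-permutations xs) ⟩
  length xs ! * suc (length xs)               ≡⟨ *-comm (length xs !) (suc (length xs)) ⟩
  suc (length xs) * length xs !               ∎
  where open ≡-Reasoning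

-- Weaving a permutation with larger letters

weave : (ℕ → ℕ) → Word → Word
weave f []       = []
weave f (t ∷ ts) = f 0 ∷ t ∷ weave (f ∘ suc) ts

weave-↭ : ∀ f ts → weave f ts ↭ ts ++ applyUpTo f (length ts)
weave-↭ f []       = ↭-refl
weave-↭ f (t ∷ ts) = ↭-trans (↭-swap (f 0) t (weave-↭ (f ∘ suc) ts))
  (↭-prep t (↭-sym (shift (f 0) ts (applyUpTo (f ∘ suc) (length ts)))))

columns : (ℕ → ℕ) → Word → List (List⁺ ℕ)
columns f []       = []
columns f (t ∷ ts) = (f 0 ∷ t ∷ []) ∷ columns (f ∘ suc) ts

consRun-< : ∀ {x y} ys D → y < x → consRun x ((y ∷ ys) ∷ D) ≡ (x ∷ y ∷ ys) ∷ D
consRun-< {x} {y} ys D y<x with y <ᵇ x | <⇒<ᵇ y<x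
... | true | _ = refl

consRun-> : ∀ {x y} ys D → x < y → consRun x ((y ∷ ys) ∷ D) ≡ (x ∷ []) ∷ (y ∷ ys) ∷ D
consRun-> {x} {y} ys D x<y with y <ᵇ x in eq
... | true  = contradiction (<ᵇ⇒< y x (subst T (sym eq) _)) (<-asym x<y)
... | false = refl

consRun-columns : ∀ t f ts → (∀ i → t < f i) → consRun t (columns f ts) ≡ (t ∷ []) ∷ columns f ts
consRun-columns t f []       t< = refl
consRun-columns t f (s ∷ ts) t< = consRun-> (s ∷ []) (columns (f ∘ suc) ts) (t< 0)

-- `f i` exceeds the letter after it, which makes a descent, and the letter before it, which makes
-- an ascent. The runs are therefore the pairs in `columns`.
descendingRuns-weave : ∀ f ts → All (λ t → ∀ i → t < f i) ts → descendingRuns (weave f ts) ≡ columns f ts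
descendingRuns-weave f []       []        = refl
descendingRuns-weave f (t ∷ ts) (t< ∷ ts<)
  rewrite descendingRuns-weave (f ∘ suc) ts (All.map (_∘ suc) ts<)
        | consRun-columns t (f ∘ suc) ts (t< ∘ suc)
  = consRun-< [] (columns (f ∘ suc) ts) (t< 0)

-- Positions count from 0. Reversing the pairs moves the letters of τ to these positions, so this is
-- a left inverse on the words used.
evens : Word → Word
evens []           = []
evens (x ∷ [])     = x ∷ []
evens (x ∷ y ∷ zs) = x ∷ evens zs

evens-reverse-columns : ∀ f ts → evens (concatMap (List.reverse ∘ toList) (columns f ts)) ≡ ts
evens-reverse-columns f []       = refl
evens-reverse-columns f (t ∷ ts) = cong (t ∷_) (evens-reverse-columns (f ∘ suc) ts)

applyUpTo-++ : ∀ {A : Set} (f : ℕ → A) m n →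
               applyUpTo f m ++ applyUpTo (f ∘ (m +_)) n ≡ applyUpTo f (m + n)
applyUpTo-++ f zero    n = refl
applyUpTo-++ f (suc m) n = cong (f 0 ∷_) (applyUpTo-++ (f ∘ suc) m n)

-- A permutation τ of [k] is recovered from P ((k+1) τ₁ (k+2) τ₂ ⋯ (2k) τₖ) = τ₁ (k+1) τ₂ (k+2) ⋯ τₖ (2k).
k!≤a[k+k] : ∀ k → k ! ≤ a (k + k)
k!≤a[k+k] k = begin
  k !                                     ≡⟨ cong _! (length-applyUpTo suc k) ⟨
  length [1⋯ k ] !                        ≡⟨ length-permutations [1⋯ k ] ⟨
  length (permutations [1⋯ k ])           ≡⟨ length-map Pweave (permutations [1⋯ k ]) ⟨
  length (map Pweave (permutations [1⋯ k ]))
    ≤⟨ Unique-⊆⇒length≤ Pweave-unique Pweave-popStacked ⟩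
  a (k + k)                               ∎
  where
  open ≤-Reasoning

  above : ℕ → ℕ
  above i = suc (k + i)

  Pweave : Word → Word
  Pweave τ = P (weave above τ)

  below : ∀ {τ} → τ ∈ permutations [1⋯ k ] → All (λ t → ∀ i → t < above i) τ
  below τ∈ = All-resp-↭ (↭-sym (∈-permutations⁻ [1⋯ k ] τ∈))
    (All.applyUpTo⁺₁ suc k λ j<k i → s≤s (≤-trans j<k (m≤m+n k i)))

  evens-Pweave : ∀ {τ} → τ ∈ permutations [1⋯ k ] → evens (Pweave τ) ≡ τ
  evens-Pweave {τ} τ∈ rewrite descendingRuns-weave above τ (below τ∈) = evens-reverse-columns above τ

  Pweave-popStacked : ∀ {σ} → σ ∈ map Pweave (permutations [1⋯ k ]) → σ ∈ popStacked (k + k)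
  Pweave-popStacked σ∈ with τ , τ∈ , refl ← ∈-map⁻ Pweave σ∈ =
    Equivalence.from (∈-popStacked⇔ (k + k)) (↭-trans (P-↭ (weave above τ)) weave↭ , weave above τ , weave↭ , refl)
    where
    τ↭ : τ ↭ [1⋯ k ]
    τ↭ = ∈-permutations⁻ [1⋯ k ] τ∈

    weave↭ : weave above τ ↭ [1⋯ k + k ]
    weave↭ = ↭-trans (weave-↭ above τ) (↭-trans
      (↭-reflexive (cong (λ n → τ ++ applyUpTo above n) (trans (↭-length τ↭) (length-applyUpTo suc k))))
      (↭-trans (++⁺ʳ (applyUpTo above k) τ↭) (↭-reflexive (applyUpTo-++ suc k k))))

  Pweave-unique : Unique (map Pweave (permutations [1⋯ k ]))
  Pweave-unique = Unique-map (permutations-unique (Unique.applyUpTo⁺₁ suc k λ i<j _ → <⇒≢ i<j ∘ suc-injective)) (λ τ∈ → τ∈)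
    where
    -- `evens` inverts `Pweave` on permutations of [k], so the induction carries the inclusion of
    -- `τs` among them.
    Unique-map : ∀ {τs} → Unique τs → (∀ {τ} → τ ∈ τs → τ ∈ permutations [1⋯ k ]) → Unique (map Pweave τs)
    Unique-map []         τs⊆ = []
    Unique-map (τ≢ ∷ τs!) τs⊆ = All.map⁺ (All.tabulate λ τ′∈ Pτ≡ → All.lookup τ≢ τ′∈
      (trans (sym (evens-Pweave (τs⊆ (here refl)))) (trans (cong evens Pτ≡) (evens-Pweave (τs⊆ (there τ′∈)))))) ∷
      Unique-map τs! (τs⊆ ∘ there)

-- Superexponential growth

[1+m]^j≤[j+m]! : ∀ m j → suc m ^ j ≤ (j + m) !
[1+m]^j≤[j+m]! m zero    = 1≤n! m
[1+m]^j≤[j+m]! m (suc j) = *-mono-≤ (s≤s (m≤n+m m j)) ([1+m]^j≤[j+m]! m j)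

-- Take n + s = 4L. Then K C^(4L) = K D^L ≤ L^L < (L+1)^L ≤ (2L)! ≤ a(4L), because each of the last
-- L factors of (2L)! is at least L + 1.
a-superexponential : ∀ K C .{{_ : NonZero C}} s → ∃[ n ] K * C ^ n < a (n + s)
a-superexponential K C s = n , (begin-strict
  K * C ^ n                      ≤⟨ *-monoʳ-≤ K (^-monoʳ-≤ C (m∸n≤m (k + k) s)) ⟩
  K * C ^ (k + k)                ≡⟨ cong (K *_) (trans (cong (C ^_) k+k≡4*L) (sym (^-*-assoc C 4 L))) ⟩
  K * D ^ L                      ≡⟨ *-assoc K D (D ^ j) ⟨
  K * D * D ^ j                  ≤⟨ *-mono-≤ KD≤L (^-monoˡ-≤ j D≤L) ⟩
  L ^ L                          <⟨ ^-monoˡ-< L ≤-refl ⟩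
  suc L ^ L                      ≤⟨ [1+m]^j≤[j+m]! L L ⟩
  k !                            ≤⟨ k!≤a[k+k] k ⟩
  a (k + k)                      ≡⟨ cong a (m∸n+n≡m s≤k+k) ⟨
  a (n + s)                      ∎)
  where
  open ≤-Reasoning
  D j L k n : ℕ
  D = C ^ 4
  -- Large enough for K D ≤ L, D ≤ L and s ≤ 4L at once. L = j + 1 splits off the factor D that
  -- absorbs K, and L > 0 makes the comparison of powers strict.
  j = K * D + D + s
  L = suc j
  k = L + L
  n = k + k ∸ s

  k+k≡4*L : k + k ≡ 4 * L
  k+k≡4*L = trans (+-assoc L L k) (cong (λ x → L + (L + (L + x))) (sym (+-identityʳ L)))

  KD≤L : K * D ≤ L
  KD≤L = m≤n⇒m≤1+n (≤-trans (m≤m+n (K * D) D) (m≤m+n _ s))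

  D≤L : D ≤ L
  D≤L = m≤n⇒m≤1+n (≤-trans (m≤n+m D (K * D)) (m≤m+n _ s))

  s≤k+k : s ≤ k + k
  s≤k+k = ≤-trans (m≤n⇒m≤1+n (m≤n+m s (K * D + D))) (≤-trans (m≤m+n L L) (m≤m+n k k))

-- Transcendence of F

F-not-exponentiallyBounded : ¬ ExponentiallyBounded F
F-not-exponentiallyBounded (s , K , M , F≤) =
  let n , K*M^n<a = a-superexponential K (suc M) s in
  ℕ.<⇒≱ K*M^n<a (ι-cancel-≤ (ℚ.≤-trans (ℚ.≤-reflexive (sym (ℚ.0≤p⇒∣p∣≡p (0≤ι (a (n ℕ.+ s)))))) (F≤ n)))

F-transcendental : ∀ {m} (p : Fin (suc m) → Poly) → ¬ (⟦ p (fromℕ m) ⟧ ≗ 0ₛ) → ¬ (evalAt p F ≗ 0ₛ)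
F-transcendental {m} p pₘ≢0 p[F]≗0 =
  algebraic⇒exponentiallyBounded m (⟦_⟧ ∘ p) (summable-⟦⟧ ∘ p) pₘ≢0 F
    (λ n → trans (sym (evalAt≗eval p F n)) (p[F]≗0 n)) F-not-exponentiallyBounded

mainTheorem6 : (m : ℕ) → m ≥ 1 →
    (p : Fin (suc m) → Poly) →
    ¬ (⟦ p (fromℕ m) ⟧ ≗ 0ₛ) →
    evalAt p F ≗ 0ₛ →
    (m + 1) * (maxDegree p + 1) > 1000
-- F satisfies no such equation, so the inequality holds vacuously.
mainTheorem6 m m≥1 p pₘ≢0 p[F]≗0 = contradiction p[F]≗0 (F-transcendental p pₘ≢0)
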